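{- There exists an absolute constant $c>0$ such that for every positive integer $k$ there exist a graph $G=(V,E,\ell)$ with nonnegative edge lengths and a set $R\subseteq V$ of $k$ terminals with the following property: every distance-preserving minor $G'=(V',E',\ell')$ of $G$ with respect to $R$ such that $V'\subseteq V$ and $d_{G'}(u,v)\ge d_G(u,v)$ for all $u,v\in V'$ has at least $c\,k^4$ vertices.
   Context: $d_H$ denotes shortest-path distance in a graph $H$ with respect to its edge lengths. Given a graph $G=(V,E,\ell)$ and terminals $R\subseteq V$, a distance-preserving minor of $G$ with respect to $R$ is a graph $G'$ with edge lengths $\ell'$ (which may differ from $\ell$) such that $G'$ is a minor of $G$ in which the terminals survive (terminals are never deleted and no two terminals are merged; a terminal may be merged with non-terminals by contraction and the resulting vertex is identified with that terminal), so $R\subseteq V(G')$, and $d_{G'}(u,v)=d_G(u,v)$ for all $u,v\in R$. The condition $V'\subseteq V$ means that every vertex of the minor $G'$ is identified with a vertex of $G$ (e.g., contracting an edge $(u,v)$ into $v$ yields a vertex identified with $v$), so that $d_G(u,v)$ makes sense for $u,v\in V'$.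
   Formalization: The edge lengths of G and of the minors G' are rational numbers instead of real numbers, so the lower bound is stated only for distance-preserving minors with rational edge lengths. -}

module Defs where

open import Data.Nat using (ℕ; suc)
open import Data.Fin using (Fin)
open import Data.Integer using (+_)
open import Data.Rational using (ℚ; 0ℚ; _≤_; _<_; _+_; _*_; _/_)
open import Data.List using (List)
open import Data.List.Membership.Propositional using (_∈_)
open import Data.List.Relation.Unary.All using (All)
open import Data.Maybe using (Maybe; just)
open import Data.Product using (Σ; _×_; _,_; ∃)
open import Data.Sum using (_⊎_)
open import Relation.Binary.PropositionalEquality using (_≡_)

ℕ→ℚ : ℕ → ℚ
ℕ→ℚ n = + n / 1

-- A finite undirected (multi)graph with rational edge lengths.
-- Vertices are Fin size; each edge is (endpoint, endpoint, length).
record Graph : Set where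
  field
    size  : ℕ
    edges : List (Fin size × Fin size × ℚ)
open Graph public

NonnegLengths : Graph → Set
NonnegLengths G = All (λ e → 0ℚ ≤ Data.Product.proj₂ (Data.Product.proj₂ e)) (edges G)

Edge : (G : Graph) → Fin (size G) → Fin (size G) → ℚ → Set
Edge G a b l = ((a , b , l) ∈ edges G) ⊎ ((b , a , l) ∈ edges G)

data Walk (G : Graph) : Fin (size G) → Fin (size G) → ℚ → Set where
  nil  : ∀ {u} → Walk G u u 0ℚ
  cons : ∀ {u w v l d} → Edge G u w l → Walk G w v d → Walk G u v (l + d)

-- d_G(u,v) = d  (shortest-path distance, attained by some walk).
-- If u and v are disconnected there is no such d (distance ∞).
IsDist : (G : Graph) → Fin (size G) → Fin (size G) → ℚ → Set
IsDist G u v d = Walk G u v d × (∀ d' → Walk G u v d' → d ≤ d')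

data ReachIn (G : Graph) (P : Fin (size G) → Set) : Fin (size G) → Fin (size G) → Set where
  here : ∀ {a} → ReachIn G P a a
  step : ∀ {a b c l} → Edge G a b l → P b → ReachIn G P b c → ReachIn G P a c

-- G' is a minor of G whose vertices are identified with vertices of G.
-- A minor model: branch : V(G) → Maybe V(G') assigns each vertex of G to at
-- most one branch set (unassigned vertices are deleted); each branch set is
-- connected in G; the vertex x of G' is identified with ι x, which lies in the
-- branch set of x; each edge of G' joins two branch sets that are joined by an
-- edge of G (edge lengths of G' are arbitrary).
record MinorModel (G G' : Graph) : Set where
  field
    ι      : Fin (size G') → Fin (size G)
    branch : Fin (size G) → Maybe (Fin (size G'))
    ι-in   : ∀ x → branch (ι x) ≡ just x
    connected : ∀ x a b → branch a ≡ just x → branch b ≡ just x →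
                ReachIn G (λ c → branch c ≡ just x) a b
    edge-model : ∀ x y l' → Edge G' x y l' →
                 Σ (Fin (size G)) λ a → Σ (Fin (size G)) λ b → Σ ℚ λ l →
                   Edge G a b l × branch a ≡ just x × branch b ≡ just y
open MinorModel public

-- G' (with model M) is a distance-preserving minor of G w.r.t. terminals
-- R : Fin k → V(G): every terminal survives as a vertex of G' identified with
-- it (no two terminals merged, as branch sets are disjoint), and
-- d_G'(x,y) = d_G(R i, R j) whenever x, y are identified with R i, R j
-- (equality of values in ℚ ∪ {∞}).
DistPreservingMinor : (G G' : Graph) → MinorModel G G' → {k : ℕ} → (Fin k → Fin (size G)) → Set
DistPreservingMinor G G' M R =
  NonnegLengths G' ×
  (∀ i → ∃ λ x → ι M x ≡ R i) ×
  (∀ i j x y → ι M x ≡ R i → ι M y ≡ R j → ∀ d →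
     (IsDist G (R i) (R j) d → IsDist G' x y d) × (IsDist G' x y d → IsDist G (R i) (R j) d))

NonContracting : (G G' : Graph) → MinorModel G G' → Set
NonContracting G G' M =
  ∀ x y d' → IsDist G' x y d' → Σ ℚ λ d → IsDist G (ι M x) (ι M y) d × d ≤ d'

{-# OPTIONS --safe #-}
module Submission where

-- Draw all segments from the integer points (0 , a T) to the points (T , b T), 0 ≤ a, b ≤ H,
-- subdivided at every integer column, where T = (2 H)!.  Two segments cross in columns only, so
-- the drawing is planar.  A step of slope s costs C + s²; by convexity each segment is the unique
-- shortest path between its ends, which linear potentials certify.  Hence the vertices of a
-- shortest walk of a non-contracting minor are identified with points of the segment.
-- If the segments (a , b) and (a' , b') cross, a < a' and b > b', then so do the corresponding
-- shortest walks of the minor: disjoint ones would lift to disjoint walks of the planar graph,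
-- contradicted by counting, modulo 2, the edges of one walk above the vertices of the other.
-- So the crossing point, which lies in the column t with (α + β) t = α T for α = a' - a and
-- β = b - b', survives.  The heights of the terminals are chosen such that the quotients
-- α / β of about (k / 4)⁴ crossings are pairwise distinct.

open import Defs
open import Data.Bool using (Bool; true; false; _xor_)
open import Data.Bool.Properties using (xor-assoc; xor-comm; xor-same)
open import Data.Nat using (ℕ; suc; zero; _^_; _!)
import Data.Nat as ℕ
import Data.Nat.Divisibility as ℕ
import Data.Nat.DivMod as ℕ
import Data.Nat.Properties as ℕ
import Data.Nat.Tactic.RingSolver as ℕ-Ring
open import Data.Integer as ℤ using (ℤ; +_; -[1+_]; 0ℤ; 1ℤ; +≤+)
import Data.Integer.Properties as ℤ
open import Data.Integer.Tactic.RingSolver using (solve-∀)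
open import Data.Rational using (ℚ; 0ℚ; _<_; _≤_; _+_; _*_; _/_; toℚᵘ)
import Data.Rational as ℚ
import Data.Rational.Properties as ℚ
import Data.Rational.Unnormalised as ℚᵘ
import Data.Rational.Unnormalised.Properties as ℚᵘ
open import Data.Fin using (Fin; zero; suc; toℕ; fromℕ; fromℕ<; inject₁; inject≤; combine; remQuot)
open import Data.Fin.Patterns using (0F; 1F; 2F; 3F)
import Data.Fin.Properties as Fin
open import Data.List using (map; cartesianProduct; allFin)
open import Data.List.Membership.Propositional using (_∈_)
open import Data.List.Membership.Propositional.Properties using (∈-map⁺; ∈-map⁻; ∈-cartesianProduct⁺; ∈-allFin)
import Data.List.Relation.Unary.All as All
open import Data.Maybe using (just)
open import Data.Maybe.Properties using (just-injective)
open import Data.Product using (Σ; ∃; _×_; _,_; proj₁; proj₂; uncurry)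
open import Data.Product.Properties using (,-injective)
open import Data.Sum as Sum using (_⊎_; inj₁; inj₂)
open import Function using (_∘_; mk⇔)
open import Function.Definitions using (Injective)
open import Relation.Nullary using (¬_; Dec; does; yes; no; contradiction)
open import Relation.Nullary.Decidable using (_×-dec_; _⊎-dec_; does-⇔; dec-true; dec-false)
open import Relation.Binary.PropositionalEquality

-- Disjoint walks in a layered drawing

module Layered
  (G : Graph) (x y : Fin (size G) → ℕ) (_⇾_ : Fin (size G) → Fin (size G) → Set) (T : ℕ)
  (xy-injective : ∀ {u v} → x u ≡ x v → y u ≡ y v → u ≡ v)
  (orient : ∀ {u v l} → Edge G u v l → u ⇾ v ⊎ v ⇾ u)
  (advance : ∀ {u v} → u ⇾ v → x v ≡ suc (x u))
  (x≤T : ∀ v → x v ℕ.≤ T)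
  -- The conclusion is weak because two arcs may end in a common vertex; order between arcs can
  -- change only by passing through one.
  (noncrossing : ∀ {u u' v v'} → u ⇾ u' → v ⇾ v' → x u ≡ x v → y u ℕ.< y v → y u' ℕ.≤ y v')
  where

  open ≡-Reasoning

  private
    V : Set
    V = Fin (size G)

  Above : V → V → Set
  Above v p = x p ≡ x v × y v ℕ.< y p

  above? : ∀ v p → Dec (Above v p)
  above? v p = (x p ℕ.≟ x v) ×-dec (y v ℕ.<? y p)

  above : V → V → Bool
  above v p = does (above? v p)

  -- The ends of an edge in the smaller and in the larger column: `⇾` points to the right, while a
  -- walk may traverse an edge either way.
  lo hi : ∀ {u v} → u ⇾ v ⊎ v ⇾ u → V
  lo {u} {v} (inj₁ _) = u
  lo {u} {v} (inj₂ _) = v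
  hi {u} {v} (inj₁ _) = v
  hi {u} {v} (inj₂ _) = u

  -- Parity of the number of steps of the walk that cross the upward ray from v,
  -- after v is shifted slightly to the right (exits) or to the left (entries).
  exits entries : ∀ {P a b} → V → ReachIn G P a b → Bool
  exits v here = false
  exits v (step e _ w) = above v (lo (orient e)) xor exits v w
  entries v here = false
  entries v (step e _ w) = above v (hi (orient e)) xor entries v w

  xor-cancelˡ : ∀ a b → a xor (a xor b) ≡ b
  xor-cancelˡ a b = trans (sym (xor-assoc a a b)) (cong (_xor b) (xor-same a))

  xor-interchange : ∀ a b c d → (a xor b) xor (c xor d) ≡ (a xor c) xor (b xor d)
  xor-interchange a b c d = begin
    (a xor b) xor (c xor d) ≡⟨ xor-assoc a b (c xor d) ⟩
    a xor (b xor (c xor d)) ≡⟨ cong (a xor_) (trans (sym (xor-assoc b c d))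
                                 (trans (cong (_xor d) (xor-comm b c)) (xor-assoc c b d))) ⟩
    a xor (c xor (b xor d)) ≡⟨ xor-assoc a c (b xor d) ⟨
    (a xor c) xor (b xor d) ∎

  above-lo-hi : ∀ v {a b} (s : a ⇾ b ⊎ b ⇾ a) →
                above v (lo s) xor above v (hi s) ≡ above v a xor above v b
  above-lo-hi v (inj₁ _) = refl
  above-lo-hi v {a} {b} (inj₂ _) = xor-comm (above v b) (above v a)

  -- Each step contributes the change of `above v` between its two ends, whichever way it is
  -- traversed; modulo 2 the sum telescopes.
  exits-xor-entries : ∀ {P a b} v (w : ReachIn G P a b) →
                      exits v w xor entries v w ≡ above v a xor above v b
  exits-xor-entries {a = a} v here = sym (xor-same (above v a))
  exits-xor-entries {a = a} {b} v (step {b = c} e _ w) = begin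
    (above v (lo s) xor exits v w) xor (above v (hi s) xor entries v w)
      ≡⟨ xor-interchange (above v (lo s)) _ _ _ ⟩
    (above v (lo s) xor above v (hi s)) xor (exits v w xor entries v w)
      ≡⟨ cong₂ _xor_ (above-lo-hi v s) (exits-xor-entries v w) ⟩
    (above v a xor above v c) xor (above v c xor above v b)
      ≡⟨ xor-assoc (above v a) _ _ ⟩
    above v a xor (above v c xor (above v c xor above v b))
      ≡⟨ cong (above v a xor_) (xor-cancelˡ (above v c) _) ⟩
    above v a xor above v b ∎
    where s = orient e

  -- Forward this is `noncrossing`, backward its contrapositive with the arcs exchanged. Distinct
  -- vertices of one column have distinct heights, which makes the weak inequalities strict.
  above-transport : ∀ {u u' v v'} → u ⇾ u' → v ⇾ v' → u ≢ v → u' ≢ v' → above u v ≡ above u' v'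
  above-transport {u} {u'} {v} {v'} uu vv u≢v u'≢v' =
    does-⇔ (mk⇔ to from) (above? u v) (above? u' v')
    where
    to : Above u v → Above u' v'
    to (xv≡xu , yu<yv) = xv'≡xu' , ℕ.≤∧≢⇒< (noncrossing uu vv (sym xv≡xu) yu<yv)
                                             (u'≢v' ∘ xy-injective (sym xv'≡xu'))
      where xv'≡xu' = trans (advance vv) (trans (cong suc xv≡xu) (sym (advance uu)))
    from : Above u' v' → Above u v
    from (xv'≡xu' , yu'<yv') = xv≡xu , ℕ.≰⇒> λ yv≤yu →
        ℕ.<⇒≱ yu'<yv' (noncrossing vv uu xv≡xu (ℕ.≤∧≢⇒< yv≤yu (u≢v ∘ sym ∘ xy-injective xv≡xu)))
      where xv≡xu = ℕ.suc-injective (trans (sym (advance vv)) (trans xv'≡xu' (advance uu)))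

  -- Both parities count edges of the walk between the columns of `u` and `u'`. The ends of such an
  -- edge satisfy `P` and so differ from `u` and `u'`; hence it is above `u` exactly if it is above
  -- `u'`.
  exits≡entries : ∀ {P a b u u'} → u ⇾ u' → ¬ P u → ¬ P u' → P a → (w : ReachIn G P a b) →
                  exits u w ≡ entries u' w
  exits≡entries uu ¬Pu ¬Pu' Pa here = refl
  exits≡entries {P} {a} {u = u} {u'} uu ¬Pu ¬Pu' Pa (step {b = c} e Pc w) =
    cong₂ _xor_ (one (orient e)) (exits≡entries uu ¬Pu ¬Pu' Pc w)
    where
    ≢P : ∀ {v t} → ¬ P v → P t → v ≢ t
    ≢P ¬Pv Pt refl = ¬Pv Pt
    one : (s : a ⇾ c ⊎ c ⇾ a) → above u (lo s) ≡ above u' (hi s)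
    one (inj₁ vv) = above-transport uu vv (≢P ¬Pu Pa) (≢P ¬Pu' Pc)
    one (inj₂ vv) = above-transport uu vv (≢P ¬Pu Pc) (≢P ¬Pu' Pa)

  ¬Above : ∀ {v p} → x p ≢ x v → above v p ≡ false
  ¬Above {v} {p} ne = dec-false (above? v p) (ne ∘ proj₁)

  exits-T : ∀ {P a b} v → x v ≡ T → (w : ReachIn G P a b) → exits v w ≡ false
  exits-T v xv here = refl
  exits-T v xv (step {a} {c} e _ w) = cong₂ _xor_ (one (orient e)) (exits-T v xv w)
    where
    stuck : ∀ {p q} → p ⇾ q → x p ≢ x v
    stuck {p} {q} pq eq = ℕ.<⇒≱ (ℕ.≤-reflexive (sym (trans (advance pq) (cong suc (trans eq xv))))) (x≤T q)
    one : (s : a ⇾ c ⊎ c ⇾ a) → above v (lo s) ≡ false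
    one (inj₁ s) = ¬Above (stuck s)
    one (inj₂ s) = ¬Above (stuck s)

  entries-0 : ∀ {P a b} v → x v ≡ 0 → (w : ReachIn G P a b) → entries v w ≡ false
  entries-0 v xv here = refl
  entries-0 v xv (step {a} {c} e _ w) = cong₂ _xor_ (one (orient e)) (entries-0 v xv w)
    where
    stuck : ∀ {p q} → p ⇾ q → x q ≢ x v
    stuck pq eq = ℕ.1+n≢0 (trans (sym (advance pq)) (trans eq xv))
    one : (s : a ⇾ c ⊎ c ⇾ a) → above v (hi s) ≡ false
    one (inj₁ s) = ¬Above (stuck s)
    one (inj₂ s) = ¬Above (stuck s)

  module _ {P Q : V → Set} (disjoint : ∀ v → P v → ¬ Q v)
           {a b c d : V} (Pa : P a) (Qc : Q c) (w : ReachIn G P a b)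
           (xa : x a ≡ 0) (xb : x b ≡ T) (xc : x c ≡ 0) (xd : x d ≡ T) where

    -- The side of w on which v lies; the terms above correct for the ends of w.
    side : V → Bool
    side v = exits v w xor above v b

    -- Moving from the right of the column of `v` to its left changes the parity by the ends of `w`
    -- above `v`, so `a` replaces `b` in the correction.
    side-entries : ∀ v → side v ≡ entries v w xor above v a
    side-entries v = begin
      exits v w xor above v b
        ≡⟨ cong (exits v w xor_) (sym (xor-cancelˡ (above v a) _)) ⟩
      exits v w xor (above v a xor (above v a xor above v b))
        ≡⟨ cong (λ t → exits v w xor (above v a xor t)) (sym (exits-xor-entries v w)) ⟩
      exits v w xor (above v a xor (exits v w xor entries v w))
        ≡⟨ cong (exits v w xor_) (trans (xor-comm (above v a) _) (xor-assoc (exits v w) _ _)) ⟩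
      exits v w xor (exits v w xor (entries v w xor above v a))
        ≡⟨ xor-cancelˡ (exits v w) _ ⟩
      entries v w xor above v a ∎

    -- An arc does not start in column `T` nor end in column 0, so both corrections vanish and
    -- `exits≡entries` remains.
    side-⇾ : ∀ {u u'} → u ⇾ u' → Q u → Q u' → side u ≡ side u'
    side-⇾ {u} {u'} uu Qu Qu' = begin
      exits u w xor above u b       ≡⟨ cong (exits u w xor_) (¬Above xb≢xu) ⟩
      exits u w xor false           ≡⟨ cong (_xor false) (exits≡entries uu (λ Pu → disjoint _ Pu Qu) (λ Pu → disjoint _ Pu Qu') Pa w) ⟩
      entries u' w xor false        ≡⟨ cong (entries u' w xor_) (¬Above xa≢xu') ⟨
      entries u' w xor above u' a   ≡⟨ side-entries u' ⟨
      side u' ∎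
      where
      xb≢xu : x b ≢ x u
      xb≢xu eq = ℕ.<⇒≱ (ℕ.≤-reflexive (sym (trans (advance uu) (cong suc (trans (sym eq) xb))))) (x≤T u')
      xa≢xu' : x a ≢ x u'
      xa≢xu' eq = ℕ.1+n≢0 (trans (sym (advance uu)) (trans (sym eq) xa))

    side-ReachIn : ∀ {u v} → Q u → ReachIn G Q u v → side u ≡ side v
    side-ReachIn Qu here = refl
    side-ReachIn {u} Qu (step {b = t} e Qt q) = trans (one (orient e)) (side-ReachIn Qt q)
      where
      one : u ⇾ t ⊎ t ⇾ u → side u ≡ side t
      one (inj₁ s) = side-⇾ s Qu Qt
      one (inj₂ s) = sym (side-⇾ s Qt Qu)

    -- `side` is constant along `q`. In column 0 there are no entries and `a` lies below `c`, which
    -- gives `false`; in column `T` there are no exits and `b` would lie above `d`, which gives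
    -- `true`.
    disjoint-ordered : ReachIn G Q c d → y a ℕ.< y c → ¬ (y d ℕ.< y b)
    disjoint-ordered q ya<yc yd<yb with () ← begin
      false                        ≡⟨ dec-false (above? c a) (λ (_ , lt) → ℕ.<-asym ya<yc lt) ⟨
      above c a                    ≡⟨ cong (_xor above c a) (entries-0 c xc w) ⟨
      entries c w xor above c a    ≡⟨ side-entries c ⟨
      side c                       ≡⟨ side-ReachIn Qc q ⟩
      side d                       ≡⟨ cong (_xor above d b) (exits-T d xd w) ⟩
      above d b                    ≡⟨ dec-true (above? d b) (trans xb (sym xd) , yd<yb) ⟩
      true                         ∎

-- Walks of a graph and of its minors

On : ∀ {G u v d} → Fin (size G) → Walk G u v d → Set
On {u = u} z nil = z ≡ u
On {u = u} z (cons e w) = z ≡ u ⊎ On z w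

on-start : ∀ {G u v d} (w : Walk G u v d) → On u w
on-start nil = refl
on-start (cons e w) = inj₁ refl

on? : ∀ {G u v d} z (w : Walk G u v d) → Dec (On z w)
on? {u = u} z nil = z Fin.≟ u
on? {u = u} z (cons e w) = (z Fin.≟ u) ⊎-dec on? z w

_++ʷ_ : ∀ {G u v w d e} → Walk G u v d → Walk G v w e → Walk G u w (d + e)
_++ʷ_ {e = e} nil q = subst (Walk _ _ _) (sym (ℚ.+-identityˡ e)) q
_++ʷ_ {e = e} (cons {l = l} {d = d} s p) q = subst (Walk _ _ _) (sym (ℚ.+-assoc l d e)) (cons s (p ++ʷ q))

splitAtVertex : ∀ {G u v d z} (w : Walk G u v d) → On z w →
                ∃ λ d₁ → ∃ λ d₂ → Walk G u z d₁ × Walk G z v d₂ × d₁ + d₂ ≡ d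
splitAtVertex nil refl = 0ℚ , 0ℚ , nil , nil , refl
splitAtVertex w@(cons {l = l} {d = d} _ _) (inj₁ refl) = 0ℚ , l + d , nil , w , ℚ.+-identityˡ _
splitAtVertex (cons {l = l} e w) (inj₂ on) =
  let d₁ , d₂ , p , q , eq = splitAtVertex w on
  in l + d₁ , d₂ , cons e p , q , trans (ℚ.+-assoc l d₁ d₂) (cong (λ s → l + s) eq)

+-cancelˡ-≤ : ∀ p {q r} → p + q ≤ p + r → q ≤ r
+-cancelˡ-≤ p {q} {r} le = subst₂ _≤_ (undo q) (undo r) (ℚ.+-monoʳ-≤ (ℚ.- p) le)
  where
  undo : ∀ s → ℚ.- p + (p + s) ≡ s
  undo s = trans (sym (ℚ.+-assoc (ℚ.- p) p s)) (trans (cong (_+ s) (ℚ.+-inverseˡ p)) (ℚ.+-identityˡ s))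

isDist-split : ∀ {G u v z d d₁ d₂} → IsDist G u v d → Walk G u z d₁ → Walk G z v d₂ →
               d₁ + d₂ ≡ d → IsDist G u z d₁ × IsDist G z v d₂
isDist-split {d₁ = d₁} {d₂} (_ , least) p q refl =
  (p , λ d' p' → +-cancelˡ-≤ d₂ (subst₂ _≤_ (ℚ.+-comm d₁ d₂) (ℚ.+-comm d' d₂) (least _ (p' ++ʷ q)))) ,
  (q , λ d' q' → +-cancelˡ-≤ d₁ (least _ (p ++ʷ q')))

ReachIn-map : ∀ {G P Q a b} → (∀ {c} → P c → Q c) → ReachIn G P a b → ReachIn G Q a b
ReachIn-map f here = here
ReachIn-map f (step e p r) = step e (f p) (ReachIn-map f r)

ReachIn-trans : ∀ {G P a b c} → ReachIn G P a b → ReachIn G P b c → ReachIn G P a c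
ReachIn-trans here s = s
ReachIn-trans (step e p r) s = step e p (ReachIn-trans r s)

module _ {G G' : Graph} (M : MinorModel G G') where

  BranchOn : ∀ {u v d} → Walk G' u v d → Fin (size G) → Set
  BranchOn w c = ∃ λ z → On z w × branch M c ≡ just z

  -- Each vertex of the walk expands to a path inside its connected branch set, and `edge-model`
  -- links consecutive branch sets.
  liftWalk : ∀ {u v d a b} (w : Walk G' u v d) → branch M a ≡ just u → branch M b ≡ just v →
             ReachIn G (BranchOn w) a b
  liftWalk {u} nil pa pb = ReachIn-map (λ eq → u , refl , eq) (connected M u _ _ pa pb)
  liftWalk {u} (cons {w = t} e w) pa pb with edge-model M _ _ _ e
  ... | p , q , _ , pq , bp , bq =
    ReachIn-trans (ReachIn-map (λ eq → u , inj₁ refl , eq) (connected M u _ _ pa bp))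
      (step pq (t , inj₂ (on-start w) , bq)
        (ReachIn-map (λ (z , on , eq) → z , inj₂ on , eq) (liftWalk w bq pb)))

  BranchOn-disjoint : ∀ {u v d u' v' d'} {w : Walk G' u v d} {w' : Walk G' u' v' d'} →
                      ¬ (∃ λ z → On z w × On z w') → ∀ c → BranchOn w c → ¬ BranchOn w' c
  BranchOn-disjoint ¬shared c (z , on , eq) (z' , on' , eq') =
    ¬shared (z , on , subst (λ t → On t _) (just-injective (trans (sym eq') eq)) on')

  -- Both parts of a shortest walk are shortest, so non-contraction bounds the corresponding
  -- distances in `G`. Hence `z` is identified with a vertex on a walk of `G` that is no longer than
  -- the walk of the minor.
  noncontracting⇒through : NonContracting G G' M → ∀ {u v d z} (w : Walk G' u v d) →
    IsDist G' u v d → On z w →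
    ∃ λ d₁ → ∃ λ d₂ → Walk G (ι M u) (ι M z) d₁ × Walk G (ι M z) (ι M v) d₂ × d₁ + d₂ ≤ d
  noncontracting⇒through nc w dist on with splitAtVertex w on
  ... | d₁ , d₂ , p , q , eq with isDist-split dist p q eq
  ... | dist₁ , dist₂ with nc _ _ _ dist₁ | nc _ _ _ dist₂
  ... | δ₁ , (p' , _) , le₁ | δ₂ , (q' , _) , le₂ =
    δ₁ , δ₂ , p' , q' , ℚ.≤-trans (ℚ.+-mono-≤ le₁ le₂) (ℚ.≤-reflexive eq)

-- Integer arithmetic

toℚᵘ-/1 : ∀ i → toℚᵘ (i / 1) ℚᵘ.≃ ℚᵘ.mkℚᵘ i 0
toℚᵘ-/1 i = ℚ.toℚᵘ-fromℚᵘ (ℚᵘ.mkℚᵘ i 0)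

/1-homo-+ : ∀ i j → i / 1 + j / 1 ≡ (i ℤ.+ j) / 1
/1-homo-+ i j = ℚ.toℚᵘ-injective (ℚᵘ.≃-trans (ℚ.toℚᵘ-homo-+ (i / 1) (j / 1))
  (ℚᵘ.≃-trans (ℚᵘ.+-cong (toℚᵘ-/1 i) (toℚᵘ-/1 j))
  (ℚᵘ.≃-trans (ℚᵘ.*≡* (cong₂ (λ a b → (a ℤ.+ b) ℤ.* 1ℤ) (ℤ.*-identityʳ i) (ℤ.*-identityʳ j)))
  (ℚᵘ.≃-sym (toℚᵘ-/1 (i ℤ.+ j))))))

/1-mono-≤ : ∀ {i j} → i ℤ.≤ j → i / 1 ≤ j / 1
/1-mono-≤ {i} {j} i≤j = ℚ.toℚᵘ-cancel-≤ (ℚᵘ.≤-respˡ-≃ (ℚᵘ.≃-sym (toℚᵘ-/1 i))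
  (ℚᵘ.≤-respʳ-≃ (ℚᵘ.≃-sym (toℚᵘ-/1 j)) (ℚᵘ.*≤* (ℤ.*-monoʳ-≤-nonNeg 1ℤ i≤j))))

/1-cancel-≤ : ∀ {i j} → i / 1 ≤ j / 1 → i ℤ.≤ j
/1-cancel-≤ {i} {j} le = ℤ.*-cancelʳ-≤-pos i j 1ℤ (ℚᵘ.drop-*≤*
  (ℚᵘ.≤-respˡ-≃ (toℚᵘ-/1 i) (ℚᵘ.≤-respʳ-≃ (toℚᵘ-/1 j) (ℚ.toℚᵘ-mono-≤ le))))

≤-by : ∀ {i j} k → 0ℤ ℤ.≤ k → i ℤ.+ k ≡ j → i ℤ.≤ j
≤-by {i} k 0≤k refl = subst (ℤ._≤ i ℤ.+ k) (ℤ.+-identityʳ i) (ℤ.+-monoʳ-≤ i 0≤k)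

0≤+ : ∀ {i j} → 0ℤ ℤ.≤ i → 0ℤ ℤ.≤ j → 0ℤ ℤ.≤ i ℤ.+ j
0≤+ = ℤ.+-mono-≤

0≤* : ∀ {i j} → 0ℤ ℤ.≤ i → 0ℤ ℤ.≤ j → 0ℤ ℤ.≤ i ℤ.* j
0≤* {+ m} {+ n} _ _ = subst (0ℤ ℤ.≤_) (ℤ.pos-* m n) (+≤+ ℕ.z≤n)

0≤i*i : ∀ i → 0ℤ ℤ.≤ i ℤ.* i
0≤i*i (+ n) = 0≤* {+ n} {+ n} (+≤+ ℕ.z≤n) (+≤+ ℕ.z≤n)
0≤i*i -[1+ n ] = +≤+ ℕ.z≤n

-- A product of two consecutive integers. It would be negative for fractions between -1 and 0, so
-- integrality of the slopes matters.
0≤i*i+i : ∀ i → 0ℤ ℤ.≤ i ℤ.* i ℤ.+ i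
0≤i*i+i (+ n) = 0≤+ (0≤i*i (+ n)) (+≤+ ℕ.z≤n)
0≤i*i+i -[1+ n ] = ℤ.i≤j⇒0≤j-i {+ suc n} {+ (suc n ℕ.* suc n)} (+≤+ (ℕ.m≤m+n (suc n) (n ℕ.* suc n)))

data Unit : ℤ → Set where
  plus  : Unit 1ℤ
  minus : Unit (ℤ.- 1ℤ)

0≤i*i+εi : ∀ {ε} → Unit ε → ∀ i → 0ℤ ℤ.≤ i ℤ.* i ℤ.+ ε ℤ.* i
0≤i*i+εi plus i = subst (λ t → 0ℤ ℤ.≤ i ℤ.* i ℤ.+ t) (sym (ℤ.*-identityˡ i)) (0≤i*i+i i)
0≤i*i+εi minus i = subst (0ℤ ℤ.≤_) (eq i) (0≤i*i+i (ℤ.- i))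
  where
  eq : ∀ i → (ℤ.- i) ℤ.* (ℤ.- i) ℤ.+ (ℤ.- i) ≡ i ℤ.* i ℤ.+ (ℤ.- 1ℤ) ℤ.* i
  eq = solve-∀

-- Parabolic step costs and their supporting functionals

module Cost (h : ℤ) where

  record Slope (i : ℤ) : Set where
    constructor slope
    field
      upper : 0ℤ ℤ.≤ h ℤ.- i
      lower : 0ℤ ℤ.≤ h ℤ.+ i

  -- The summand h * h + h is large enough for descent≤cost, which concerns steps to the left.
  cost : ℤ → ℤ
  cost σ = (h ℤ.* h ℤ.+ h) ℤ.+ σ ℤ.* σ

  -- The functional dx ε m * x + dy ε m * y supports the parabola cost at the slope m when
  -- ε = 0; since slopes are integers it stays below cost also when tilted by ε = ± 1.
  dx dy : ℤ → ℤ → ℤ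
  dx ε m = (h ℤ.* h ℤ.+ h) ℤ.- m ℤ.* m ℤ.- ε ℤ.* m
  dy ε m = m ℤ.+ m ℤ.+ ε

  -- The slack is `(m - σ)² + ε (m - σ)`, nonnegative on integers.
  ascent≤cost : ∀ {ε} → Unit ε → ∀ m σ → dx ε m ℤ.+ dy ε m ℤ.* σ ℤ.≤ cost σ
  ascent≤cost {ε} u m σ = ≤-by _ (0≤i*i+εi u (m ℤ.- σ)) (eq h ε m σ)
    where
    eq : ∀ h ε m σ →
         ((h ℤ.* h ℤ.+ h) ℤ.- m ℤ.* m ℤ.- ε ℤ.* m ℤ.+ (m ℤ.+ m ℤ.+ ε) ℤ.* σ)
           ℤ.+ ((m ℤ.- σ) ℤ.* (m ℤ.- σ) ℤ.+ ε ℤ.* (m ℤ.- σ))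
         ≡ (h ℤ.* h ℤ.+ h) ℤ.+ σ ℤ.* σ
    eq = solve-∀

  -- The slack is `(σ + m)² + 2 (h - m) (h + m) + (2 h + ε (σ - m))`; the last two summands are
  -- nonnegative because slopes lie between `- h` and `h`.
  descent≤cost : ∀ {ε} → Unit ε → ∀ {m σ} → Slope m → Slope σ →
                 ℤ.- (dx ε m ℤ.+ dy ε m ℤ.* σ) ℤ.≤ cost σ
  descent≤cost {ε} u {m} {σ} (slope mu ml) (slope σu σl) =
    ≤-by _ (0≤+ (0≤+ (0≤i*i (σ ℤ.+ m)) (0≤+ (0≤* mu ml) (0≤* mu ml))) (linear u)) (eq h ε m σ)
    where
    linear : ∀ {ε} → Unit ε → 0ℤ ℤ.≤ h ℤ.+ h ℤ.+ ε ℤ.* (σ ℤ.- m)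
    linear plus = subst (0ℤ ℤ.≤_) (e h m σ) (0≤+ mu σl)
      where
      e : ∀ h m σ → (h ℤ.- m) ℤ.+ (h ℤ.+ σ) ≡ h ℤ.+ h ℤ.+ 1ℤ ℤ.* (σ ℤ.- m)
      e = solve-∀
    linear minus = subst (0ℤ ℤ.≤_) (e h m σ) (0≤+ ml σu)
      where
      e : ∀ h m σ → (h ℤ.+ m) ℤ.+ (h ℤ.- σ) ≡ h ℤ.+ h ℤ.+ (ℤ.- 1ℤ) ℤ.* (σ ℤ.- m)
      e = solve-∀
    eq : ∀ h ε m σ →
         (ℤ.- ((h ℤ.* h ℤ.+ h) ℤ.- m ℤ.* m ℤ.- ε ℤ.* m ℤ.+ (m ℤ.+ m ℤ.+ ε) ℤ.* σ))
           ℤ.+ ((σ ℤ.+ m) ℤ.* (σ ℤ.+ m)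
             ℤ.+ ((h ℤ.- m) ℤ.* (h ℤ.+ m) ℤ.+ (h ℤ.- m) ℤ.* (h ℤ.+ m))
             ℤ.+ (h ℤ.+ h ℤ.+ ε ℤ.* (σ ℤ.- m)))
         ≡ (h ℤ.* h ℤ.+ h) ℤ.+ σ ℤ.* σ
    eq = solve-∀

-- Since |Δ| divides the gap A T + Δ t, a positive gap is at least |Δ|.
gap-step : ∀ {T} H A Δ t → (∀ n → suc n ℕ.≤ H ℕ.+ H → suc n ℕ.∣ T) →
           ℤ.- Δ ℤ.≤ + (H ℕ.+ H) →
           0ℤ ℤ.< A ℤ.* + T ℤ.+ Δ ℤ.* t → 0ℤ ℤ.≤ (A ℤ.* + T ℤ.+ Δ ℤ.* t) ℤ.+ Δ
gap-step H A (+ n) t div bound pos = 0≤+ (ℤ.<⇒≤ pos) (+≤+ ℕ.z≤n)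
gap-step H A -[1+ n ] t div bound pos with div n (ℤ.drop‿+≤+ bound)
... | ℕ.divides q refl = subst (0ℤ ℤ.≤_) (sym (trans eq₁ (eq₂ (+ suc n) A (+ q) t)))
        (0≤* {+ suc n} (+≤+ ℕ.z≤n) (ℤ.i≤j⇒0≤j-i {1ℤ} {A ℤ.* + q ℤ.- t} (ℤ.i<j⇒suc[i]≤j 0<)))
  where
  eq₁ : A ℤ.* + (q ℕ.* suc n) ℤ.+ -[1+ n ] ℤ.* t ℤ.+ -[1+ n ]
        ≡ A ℤ.* (+ q ℤ.* + suc n) ℤ.+ (ℤ.- (+ suc n)) ℤ.* t ℤ.+ (ℤ.- (+ suc n))
  eq₁ = cong (λ z → A ℤ.* z ℤ.+ -[1+ n ] ℤ.* t ℤ.+ -[1+ n ]) (ℤ.pos-* q (suc n))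
  eq₂ : ∀ s A q t → A ℤ.* (q ℤ.* s) ℤ.+ (ℤ.- s) ℤ.* t ℤ.+ (ℤ.- s) ≡ s ℤ.* (A ℤ.* q ℤ.- t ℤ.- 1ℤ)
  eq₂ = solve-∀
  eq₃ : ∀ s A q t → A ℤ.* (q ℤ.* s) ℤ.+ (ℤ.- s) ℤ.* t ≡ s ℤ.* (A ℤ.* q ℤ.- t)
  eq₃ = solve-∀
  0< : 0ℤ ℤ.< A ℤ.* + q ℤ.- t
  0< = ℤ.*-cancelˡ-<-nonNeg (+ suc n) (subst₂ ℤ._<_ (sym (ℤ.*-zeroʳ (+ suc n)))
         (trans (cong (λ z → A ℤ.* z ℤ.+ -[1+ n ] ℤ.* t) (ℤ.pos-* q (suc n))) (eq₃ (+ suc n) A (+ q) t)) pos)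

line-height : ∀ {T} a b {t} → t ℕ.≤ T →
              + (a ℕ.* (T ℕ.∸ t) ℕ.+ b ℕ.* t) ≡ + a ℤ.* + T ℤ.+ (+ b ℤ.- + a) ℤ.* + t
line-height {T} a b {t} t≤T = begin
  + (a ℕ.* s ℕ.+ b ℕ.* t)                              ≡⟨ ℤ.pos-+ (a ℕ.* s) (b ℕ.* t) ⟩
  + (a ℕ.* s) ℤ.+ + (b ℕ.* t)                          ≡⟨ cong₂ ℤ._+_ (ℤ.pos-* a s) (ℤ.pos-* b t) ⟩
  + a ℤ.* + s ℤ.+ + b ℤ.* + t                          ≡⟨ eq (+ a) (+ b) (+ s) (+ t) ⟩
  + a ℤ.* (+ t ℤ.+ + s) ℤ.+ (+ b ℤ.- + a) ℤ.* + t      ≡⟨ cong (λ z → + a ℤ.* z ℤ.+ (+ b ℤ.- + a) ℤ.* + t)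
                                                           (trans (sym (ℤ.pos-+ t s)) (cong +_ (ℕ.m+[n∸m]≡n t≤T))) ⟩
  + a ℤ.* + T ℤ.+ (+ b ℤ.- + a) ℤ.* + t                ∎
  where
  open ≡-Reasoning
  s = T ℕ.∸ t
  eq : ∀ a b s t → a ℤ.* s ℤ.+ b ℤ.* t ≡ a ℤ.* (t ℤ.+ s) ℤ.+ (b ℤ.- a) ℤ.* t
  eq = solve-∀

-- The grid of lines

module Grid (H T : ℕ) (div : ∀ n → suc n ℕ.≤ H ℕ.+ H → suc n ℕ.∣ T) where

  open Cost (+ H)

  rows : ℕ
  rows = suc (H ℕ.* T)

  -- Every lattice point of the rectangle is a vertex, isolated if it lies on no segment. With
  -- coordinates as vertices, segments through the same lattice point share it automatically.
  V : Set
  V = Fin (suc T ℕ.* rows)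

  x y : V → ℕ
  x v = toℕ (proj₁ (remQuot {suc T} rows v))
  y v = toℕ (proj₂ (remQuot {suc T} rows v))

  xy-injective : ∀ {u v} → x u ≡ x v → y u ≡ y v → u ≡ v
  xy-injective {u} {v} xu≡xv yu≡yv = begin
    u                                                          ≡⟨ Fin.combine-remQuot {suc T} rows u ⟨
    combine (proj₁ (remQuot {suc T} rows u)) (proj₂ (remQuot {suc T} rows u))
      ≡⟨ cong₂ combine (Fin.toℕ-injective xu≡xv) (Fin.toℕ-injective yu≡yv) ⟩
    combine (proj₁ (remQuot {suc T} rows v)) (proj₂ (remQuot {suc T} rows v))
      ≡⟨ Fin.combine-remQuot {suc T} rows v ⟩
    v                                                          ∎
    where open ≡-Reasoning

  Height : Set
  Height = Fin (suc H)

  -- The slope: a segment rises by `(b - a) T` over `T` columns.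
  σ : Height → Height → ℤ
  σ a b = + toℕ b ℤ.- + toℕ a

  height : Height → Height → ℕ → ℕ
  height a b t = toℕ a ℕ.* (T ℕ.∸ t) ℕ.+ toℕ b ℕ.* t

  height-bound : ∀ a b (t : Fin (suc T)) → height a b (toℕ t) ℕ.< rows
  height-bound a b t = ℕ.s≤s (begin
    toℕ a ℕ.* (T ℕ.∸ toℕ t) ℕ.+ toℕ b ℕ.* toℕ t
      ≤⟨ ℕ.+-mono-≤ (ℕ.*-monoˡ-≤ (T ℕ.∸ toℕ t) (Fin.toℕ≤pred[n] a)) (ℕ.*-monoˡ-≤ (toℕ t) (Fin.toℕ≤pred[n] b)) ⟩
    H ℕ.* (T ℕ.∸ toℕ t) ℕ.+ H ℕ.* toℕ t   ≡⟨ ℕ.*-distribˡ-+ H (T ℕ.∸ toℕ t) (toℕ t) ⟨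
    H ℕ.* (T ℕ.∸ toℕ t ℕ.+ toℕ t)         ≡⟨ cong (H ℕ.*_) (ℕ.m∸n+n≡m (Fin.toℕ≤pred[n] t)) ⟩
    H ℕ.* T                               ∎)
    where open ℕ.≤-Reasoning

  -- The point in column t of the segment joining (0 , a T) to (T , b T).
  point : Height → Height → Fin (suc T) → V
  point a b t = combine t (fromℕ< (height-bound a b t))

  x-point : ∀ a b t → x (point a b t) ≡ toℕ t
  x-point a b t = cong (toℕ ∘ proj₁) (Fin.remQuot-combine {suc T} t (fromℕ< (height-bound a b t)))

  y-point : ∀ a b t → y (point a b t) ≡ height a b (toℕ t)
  y-point a b t = trans (cong (toℕ ∘ proj₂) (Fin.remQuot-combine {suc T} t (fromℕ< (height-bound a b t))))
                        (Fin.toℕ-fromℕ< (height-bound a b t))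

  y-pointℤ : ∀ a b t → + y (point a b t) ≡ + toℕ a ℤ.* + T ℤ.+ σ a b ℤ.* + toℕ t
  y-pointℤ a b t = trans (cong +_ (y-point a b t)) (line-height (toℕ a) (toℕ b) (Fin.toℕ≤pred[n] t))

  segment : Fin T × Height × Height → V × V × ℚ
  segment (t , a , b) = point a b (inject₁ t) , point a b (suc t) , cost (σ a b) / 1

  G : Graph
  G = record
    { size  = suc T ℕ.* rows
    ; edges = map segment (cartesianProduct (allFin T) (cartesianProduct (allFin (suc H)) (allFin (suc H))))
    }

  data Segment : V → V → ℚ → Set where
    seg : ∀ t a b → Segment (point a b (inject₁ t)) (point a b (suc t)) (cost (σ a b) / 1)

  ∈⇒Segment : ∀ {u v l} → (u , v , l) ∈ edges G → Segment u v l
  ∈⇒Segment uv∈ with ∈-map⁻ segment uv∈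
  ... | (t , a , b) , _ , refl = seg t a b

  seg∈ : ∀ t a b → segment (t , a , b) ∈ edges G
  seg∈ t a b = ∈-map⁺ segment (∈-cartesianProduct⁺ (∈-allFin t) (∈-cartesianProduct⁺ (∈-allFin a) (∈-allFin b)))

  0≤cost : ∀ i → 0ℤ ℤ.≤ cost i
  0≤cost i = 0≤+ (0≤+ (0≤i*i (+ H)) (+≤+ ℕ.z≤n)) (0≤i*i i)

  nonneg : NonnegLengths G
  nonneg = All.tabulate λ e∈ → nonneg-Segment (∈⇒Segment e∈)
    where
    nonneg-Segment : ∀ {u v l} → Segment u v l → 0ℚ ≤ l
    nonneg-Segment (seg t a b) = /1-mono-≤ (0≤cost (σ a b))

  _⇾_ : V → V → Set
  u ⇾ v = ∃ (Segment u v)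

  orient : ∀ {u v l} → Edge G u v l → u ⇾ v ⊎ v ⇾ u
  orient = Sum.map (λ e → _ , ∈⇒Segment e) (λ e → _ , ∈⇒Segment e)

  advance : ∀ {u v} → u ⇾ v → x v ≡ suc (x u)
  advance (_ , seg t a b) = trans (x-point a b (suc t))
    (cong suc (trans (sym (Fin.toℕ-inject₁ t)) (sym (x-point a b (inject₁ t)))))

  x≤T : ∀ v → x v ℕ.≤ T
  x≤T v = Fin.toℕ≤pred[n] (proj₁ (remQuot {suc T} rows v))

  slope-σ : ∀ a b → Slope (σ a b)
  slope-σ a b = record
    { upper = subst (0ℤ ℤ.≤_) (eq₁ (+ H) (+ toℕ a) (+ toℕ b)) (0≤+ (0≤H- b) (+≤+ ℕ.z≤n))
    ; lower = subst (0ℤ ℤ.≤_) (eq₂ (+ H) (+ toℕ a) (+ toℕ b)) (0≤+ (0≤H- a) (+≤+ ℕ.z≤n))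
    }
    where
    0≤H- : ∀ (a : Height) → 0ℤ ℤ.≤ + H ℤ.- + toℕ a
    0≤H- a = ℤ.i≤j⇒0≤j-i (+≤+ (Fin.toℕ≤pred[n] a))
    eq₁ : ∀ h a b → (h ℤ.- b) ℤ.+ a ≡ h ℤ.- (b ℤ.- a)
    eq₁ = solve-∀
    eq₂ : ∀ h a b → (h ℤ.- a) ℤ.+ b ≡ h ℤ.+ (b ℤ.- a)
    eq₂ = solve-∀

  y-start : ∀ (t : Fin T) a b →
            + y (point a b (inject₁ t)) ≡ + toℕ a ℤ.* + T ℤ.+ σ a b ℤ.* + toℕ t
  y-start t a b = trans (y-pointℤ a b (inject₁ t)) (cong (λ s → + toℕ a ℤ.* + T ℤ.+ σ a b ℤ.* + s) (Fin.toℕ-inject₁ t))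

  y-step : ∀ (t : Fin T) a b → + y (point a b (suc t)) ≡ + y (point a b (inject₁ t)) ℤ.+ σ a b
  y-step t a b = trans (y-pointℤ a b (suc t))
    (trans (eq (+ toℕ a) (+ T) (σ a b) (+ toℕ t)) (cong (ℤ._+ σ a b) (sym (y-start t a b))))
    where
    eq : ∀ a T m t → a ℤ.* T ℤ.+ m ℤ.* (1ℤ ℤ.+ t) ≡ a ℤ.* T ℤ.+ m ℤ.* t ℤ.+ m
    eq = solve-∀

  -- The gap between two lines is the affine function `A T + Δ t` of the column, where `- Δ` is at
  -- most `2 H` as a difference of slopes. By `gap-step` a positive gap is not negative one column
  -- later.
  noncrossing : ∀ {u u' v v'} → u ⇾ u' → v ⇾ v' → x u ≡ x v → y u ℕ.< y v → y u' ℕ.≤ y v'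
  noncrossing (_ , seg t a b) (_ , seg t' a' b') xu≡xv yu<yv
    with Fin.toℕ-injective {i = t} {j = t'}
           (trans (sym (Fin.toℕ-inject₁ t)) (trans (sym (x-point a b (inject₁ t)))
             (trans xu≡xv (trans (x-point a' b' (inject₁ t')) (Fin.toℕ-inject₁ t')))))
  ... | refl = ℤ.drop‿+≤+ (ℤ.0≤i-j⇒j≤i (subst (0ℤ ℤ.≤_) next
                 (gap-step H A Δ (+ toℕ t) div bound (subst (0ℤ ℤ.<_) now (0<j-i (ℤ.+<+ yu<yv))))))
    where
    A Δ : ℤ
    A = + toℕ a' ℤ.- + toℕ a
    Δ = σ a' b' ℤ.- σ a b
    0<j-i : ∀ {i j} → i ℤ.< j → 0ℤ ℤ.< j ℤ.- i
    0<j-i {i} {j} i<j = subst (ℤ._< j ℤ.- i) (ℤ.+-inverseʳ i) (ℤ.+-monoˡ-< (ℤ.- i) i<j)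
    now : + y (point a' b' (inject₁ t)) ℤ.- + y (point a b (inject₁ t)) ≡ A ℤ.* + T ℤ.+ Δ ℤ.* + toℕ t
    now = trans (cong₂ ℤ._-_ (y-start t a' b') (y-start t a b))
            (eq (+ toℕ a) (+ toℕ a') (+ T) (σ a b) (σ a' b') (+ toℕ t))
      where
      eq : ∀ a a' T m m' t → (a' ℤ.* T ℤ.+ m' ℤ.* t) ℤ.- (a ℤ.* T ℤ.+ m ℤ.* t)
                             ≡ (a' ℤ.- a) ℤ.* T ℤ.+ (m' ℤ.- m) ℤ.* t
      eq = solve-∀
    next : A ℤ.* + T ℤ.+ Δ ℤ.* + toℕ t ℤ.+ Δ ≡ + y (point a' b' (suc t)) ℤ.- + y (point a b (suc t))
    next = trans (cong (ℤ._+ Δ) (sym now))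
             (trans (eq (+ y (point a b (inject₁ t))) (+ y (point a' b' (inject₁ t))) (σ a b) (σ a' b'))
               (sym (cong₂ ℤ._-_ (y-step t a' b') (y-step t a b))))
      where
      eq : ∀ p q m m' → (q ℤ.- p) ℤ.+ (m' ℤ.- m) ≡ (q ℤ.+ m') ℤ.- (p ℤ.+ m)
      eq = solve-∀
    bound : ℤ.- Δ ℤ.≤ + (H ℕ.+ H)
    bound = ≤-by _ (0≤+ (Slope.upper (slope-σ a b)) (Slope.lower (slope-σ a' b')))
              (trans (eq (+ H) (σ a b) (σ a' b')) (sym (ℤ.pos-+ H H)))
      where
      eq : ∀ h m m' → (ℤ.- (m' ℤ.- m)) ℤ.+ ((h ℤ.- m) ℤ.+ (h ℤ.+ m')) ≡ h ℤ.+ h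
      eq = solve-∀

  open Layered G x y _⇾_ T xy-injective orient advance x≤T noncrossing public using (disjoint-ordered)

  -- Potentials and unique shortest paths

  potential : ℤ → ℤ → V → ℤ
  potential ε m v = dx ε m ℤ.* + x v ℤ.+ dy ε m ℤ.* + y v

  potential-step : ∀ ε m t a b → potential ε m (point a b (suc t)) ≡
                   potential ε m (point a b (inject₁ t)) ℤ.+ (dx ε m ℤ.+ dy ε m ℤ.* σ a b)
  potential-step ε m t a b =
    trans (cong₂ (λ X Y → dx ε m ℤ.* X ℤ.+ dy ε m ℤ.* Y) (cong +_ (advance (_ , seg t a b))) (y-step t a b))
          (eq (dx ε m) (dy ε m) (+ x (point a b (inject₁ t))) (+ y (point a b (inject₁ t))) (σ a b))
    where
    eq : ∀ p q X Y s → p ℤ.* (1ℤ ℤ.+ X) ℤ.+ q ℤ.* (Y ℤ.+ s) ≡ p ℤ.* X ℤ.+ q ℤ.* Y ℤ.+ (p ℤ.+ q ℤ.* s)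
    eq = solve-∀

  -- Traversal to the right is covered by `ascent≤cost`, traversal to the left by `descent≤cost`.
  -- Exposing the length as an integer `z` keeps the remaining arithmetic in `ℤ`.
  potential-edge : ∀ {u v l} → Edge G u v l → ∃ λ z → l ≡ z / 1 ×
    (∀ {ε m} → Unit ε → Slope m → potential ε m v ℤ.≤ potential ε m u ℤ.+ z)
  potential-edge (inj₁ e) with ∈⇒Segment e
  ... | seg t a b = cost (σ a b) , refl , λ {ε} {m} unit _ →
    subst (ℤ._≤ potential ε m (point a b (inject₁ t)) ℤ.+ cost (σ a b))
          (sym (potential-step ε m t a b))
          (ℤ.+-monoʳ-≤ (potential ε m (point a b (inject₁ t))) (ascent≤cost unit m (σ a b)))
  potential-edge (inj₂ e) with ∈⇒Segment e
  ... | seg t a b = cost (σ a b) , refl , λ {ε} {m} unit slope-m →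
    let p = potential ε m (point a b (inject₁ t))
        r = dx ε m ℤ.+ dy ε m ℤ.* σ a b
    in subst (λ q → p ℤ.≤ q ℤ.+ cost (σ a b)) (sym (potential-step ε m t a b))
         (ℤ.≤-trans (ℤ.≤-reflexive (eq p r)) (ℤ.+-monoʳ-≤ (p ℤ.+ r) (descent≤cost unit slope-m (slope-σ a b))))
    where
    eq : ∀ p r → p ≡ (p ℤ.+ r) ℤ.+ ℤ.- r
    eq = solve-∀

  potential-walk : ∀ {u v d} → Walk G u v d → ∃ λ z → d ≡ z / 1 ×
    (∀ {ε m} → Unit ε → Slope m → potential ε m v ℤ.≤ potential ε m u ℤ.+ z)
  potential-walk {u} nil = 0ℤ , refl , λ {ε} {m} _ _ → ℤ.≤-reflexive (sym (ℤ.+-identityʳ (potential ε m u)))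
  potential-walk {u} (cons e w) with potential-edge e | potential-walk w
  ... | z , refl , le | z' , refl , le' = z ℤ.+ z' , /1-homo-+ z z' , λ {ε} {m} unit slope-m →
    ℤ.≤-trans (le' unit slope-m) (ℤ.≤-trans (ℤ.+-monoˡ-≤ z' (le unit slope-m)) (ℤ.≤-reflexive (ℤ.+-assoc (potential ε m u) z z')))

  lineWalk : ∀ a b j (t : Fin (suc T)) → toℕ t ℕ.+ j ≡ T →
             Walk G (point a b t) (point a b (fromℕ T)) ((+ j ℤ.* cost (σ a b)) / 1)
  lineWalk a b zero t t≡T = subst (λ s → Walk G (point a b t) (point a b s) 0ℚ)
    (Fin.toℕ-injective (trans (trans (sym (ℕ.+-identityʳ (toℕ t))) t≡T) (sym (Fin.toℕ-fromℕ T)))) nil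
  lineWalk a b (suc j) t t+j≡T = subst₂ (λ s d → Walk G (point a b s) (point a b (fromℕ T)) d) start length
      (cons (inj₁ (seg∈ t' a b)) (lineWalk a b j (suc t') suc-t'))
    where
    t<T : toℕ t ℕ.< T
    t<T = subst (toℕ t ℕ.<_) t+j≡T (ℕ.m<m+n (toℕ t) (ℕ.s≤s ℕ.z≤n))
    t' : Fin T
    t' = fromℕ< t<T
    start : inject₁ t' ≡ t
    start = Fin.toℕ-injective (trans (Fin.toℕ-inject₁ t') (Fin.toℕ-fromℕ< t<T))
    suc-t' : suc (toℕ t') ℕ.+ j ≡ T
    suc-t' = trans (cong (λ s → suc s ℕ.+ j) (Fin.toℕ-fromℕ< t<T)) (trans (sym (ℕ.+-suc (toℕ t) j)) t+j≡T)
    eq : ∀ j c → c ℤ.+ j ℤ.* c ≡ (1ℤ ℤ.+ j) ℤ.* c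
    eq = solve-∀
    length : cost (σ a b) / 1 + (+ j ℤ.* cost (σ a b)) / 1 ≡ (+ suc j ℤ.* cost (σ a b)) / 1
    length = trans (/1-homo-+ (cost (σ a b)) (+ j ℤ.* cost (σ a b)))
                   (cong (_/ 1) (eq (+ j) (cost (σ a b))))

  -- The end of a segment depends on one of its two heights only (`point-0`, `point-T`); the
  -- horizontal segment serves as representative.
  left right : Height → V
  left a = point a a zero
  right b = point b b (fromℕ T)

  x-left : ∀ a → x (left a) ≡ 0
  x-left a = x-point a a zero

  x-right : ∀ b → x (right b) ≡ T
  x-right b = trans (x-point b b (fromℕ T)) (Fin.toℕ-fromℕ T)

  y-left : ∀ a → y (left a) ≡ toℕ a ℕ.* T
  y-left a = trans (y-point a a zero)
    (trans (cong (toℕ a ℕ.* T ℕ.+_) (ℕ.*-zeroʳ (toℕ a))) (ℕ.+-identityʳ _))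

  height-T : ∀ a b → height a b T ≡ toℕ b ℕ.* T
  height-T a b = trans (cong (λ s → toℕ a ℕ.* s ℕ.+ toℕ b ℕ.* T) (ℕ.n∸n≡0 T)) (cong (ℕ._+ toℕ b ℕ.* T) (ℕ.*-zeroʳ (toℕ a)))

  y-end : ∀ a b → y (point a b (fromℕ T)) ≡ toℕ b ℕ.* T
  y-end a b = trans (y-point a b (fromℕ T)) (trans (cong (height a b) (Fin.toℕ-fromℕ T)) (height-T a b))

  y-right : ∀ b → y (right b) ≡ toℕ b ℕ.* T
  y-right b = y-end b b

  point-0 : ∀ a b → point a b zero ≡ left a
  point-0 a b = xy-injective (trans (x-point a b zero) (sym (x-left a)))
    (trans (y-point a b zero) (trans (cong (toℕ a ℕ.* T ℕ.+_) (ℕ.*-zeroʳ (toℕ b)))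
      (trans (ℕ.+-identityʳ _) (sym (y-left a)))))

  point-T : ∀ a b → point a b (fromℕ T) ≡ right b
  point-T a b = xy-injective (trans (x-point a b (fromℕ T)) (trans (Fin.toℕ-fromℕ T) (sym (x-right b))))
    (trans (y-end a b) (sym (y-right b)))

  lineLength : Height → Height → ℤ
  lineLength a b = + T ℤ.* cost (σ a b)

  flip : ∀ {ε} → Unit ε → Unit (ℤ.- ε)
  flip plus = minus
  flip minus = plus

  y-rightℤ : ∀ a b → + y (right b) ≡ + toℕ a ℤ.* + T ℤ.+ σ a b ℤ.* + T
  y-rightℤ a b = trans (cong +_ (y-right b)) (trans (ℤ.pos-* (toℕ b) T) (eq (+ toℕ a) (+ toℕ b) (+ T)))
    where
    eq : ∀ a b T → b ℤ.* T ≡ a ℤ.* T ℤ.+ (b ℤ.- a) ℤ.* T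
    eq = solve-∀

  y-leftℤ : ∀ a → + y (left a) ≡ + toℕ a ℤ.* + T
  y-leftℤ a = trans (cong +_ (y-left a)) (ℤ.pos-* (toℕ a) T)

  potential-left : ∀ ε m a → potential ε m (left a) ≡ dx ε m ℤ.* 0ℤ ℤ.+ dy ε m ℤ.* (+ toℕ a ℤ.* + T)
  potential-left ε m a = cong₂ (λ X Y → dx ε m ℤ.* X ℤ.+ dy ε m ℤ.* Y) (cong +_ (x-left a)) (y-leftℤ a)

  potential-right : ∀ ε m a b → potential ε m (right b) ≡
                    dx ε m ℤ.* + T ℤ.+ dy ε m ℤ.* (+ toℕ a ℤ.* + T ℤ.+ σ a b ℤ.* + T)
  potential-right ε m a b = cong₂ (λ X Y → dx ε m ℤ.* X ℤ.+ dy ε m ℤ.* Y) (cong +_ (x-right b)) (y-rightℤ a b)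

  -- Measuring one half of the walk with ε and the other with - ε makes the
  -- contribution of the line cancel, leaving twice the deviation of w from it.
  deviation : ∀ {ε} → Unit ε → ∀ a b {w d₁ d₂} → Walk G (left a) w d₁ → Walk G w (right b) d₂ →
    d₁ + d₂ ≤ lineLength a b / 1 →
    0ℤ ℤ.≤ ε ℤ.* ((+ toℕ a ℤ.* + T ℤ.+ σ a b ℤ.* + x w ℤ.- + y w) ℤ.+ (+ toℕ a ℤ.* + T ℤ.+ σ a b ℤ.* + x w ℤ.- + y w))
  deviation {ε} unit a b {w} p q le with potential-walk p | potential-walk q
  ... | z₁ , refl , le₁ | z₂ , refl , le₂ =
    subst (0ℤ ℤ.≤_) total (0≤+ (0≤+ (ℤ.i≤j⇒0≤j-i (le₁ unit m)) (ℤ.i≤j⇒0≤j-i (le₂ (flip unit) m)))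
      (ℤ.i≤j⇒0≤j-i (/1-cancel-≤ {z₁ ℤ.+ z₂} {lineLength a b} (subst (_≤ lineLength a b / 1) (/1-homo-+ z₁ z₂) le))))
    where
    m = slope-σ a b
    eq : ∀ h ε m A T X Y z₁ z₂ →
      let C = h ℤ.* h ℤ.+ h
          ψ = λ e X Y → (C ℤ.- m ℤ.* m ℤ.- e ℤ.* m) ℤ.* X ℤ.+ (m ℤ.+ m ℤ.+ e) ℤ.* Y
      in (ψ ε 0ℤ A ℤ.+ z₁ ℤ.- ψ ε X Y)
           ℤ.+ (ψ (ℤ.- ε) X Y ℤ.+ z₂ ℤ.- ψ (ℤ.- ε) T (A ℤ.+ m ℤ.* T))
           ℤ.+ (T ℤ.* (C ℤ.+ m ℤ.* m) ℤ.- (z₁ ℤ.+ z₂))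
         ≡ ε ℤ.* ((A ℤ.+ m ℤ.* X ℤ.- Y) ℤ.+ (A ℤ.+ m ℤ.* X ℤ.- Y))
    eq = solve-∀
    total : (potential ε (σ a b) (left a) ℤ.+ z₁ ℤ.- potential ε (σ a b) w)
              ℤ.+ (potential (ℤ.- ε) (σ a b) w ℤ.+ z₂ ℤ.- potential (ℤ.- ε) (σ a b) (right b))
              ℤ.+ (lineLength a b ℤ.- (z₁ ℤ.+ z₂))
            ≡ ε ℤ.* ((+ toℕ a ℤ.* + T ℤ.+ σ a b ℤ.* + x w ℤ.- + y w) ℤ.+ (+ toℕ a ℤ.* + T ℤ.+ σ a b ℤ.* + x w ℤ.- + y w))
    total = trans (cong₂ (λ l r → (l ℤ.+ z₁ ℤ.- potential ε (σ a b) w)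
                                    ℤ.+ (potential (ℤ.- ε) (σ a b) w ℤ.+ z₂ ℤ.- r)
                                    ℤ.+ (lineLength a b ℤ.- (z₁ ℤ.+ z₂)))
                     (potential-left ε (σ a b) a) (potential-right (ℤ.- ε) (σ a b) a b))
      (eq (+ H) ε (σ a b) (+ toℕ a ℤ.* + T) (+ T) (+ x w) (+ y w) z₁ z₂)

  0≤i+i⇒0≤i : ∀ i → 0ℤ ℤ.≤ i ℤ.+ i → 0ℤ ℤ.≤ i
  0≤i+i⇒0≤i (+ n) _ = +≤+ ℕ.z≤n

  -- Uniqueness of the shortest path: `deviation` with both signs shows that twice the deviation `Z`
  -- and its negative are nonnegative.
  through⇒onLine : ∀ a b {w d₁ d₂} → Walk G (left a) w d₁ → Walk G w (right b) d₂ →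
    d₁ + d₂ ≤ lineLength a b / 1 → + y w ≡ + toℕ a ℤ.* + T ℤ.+ σ a b ℤ.* + x w
  through⇒onLine a b {w} p q le = ℤ.≤-antisym (ℤ.0≤i-j⇒j≤i 0≤Z)
      (ℤ.0≤i-j⇒j≤i (subst (0ℤ ℤ.≤_) (eq₃ L (+ y w)) 0≤-Z))
    where
    L Z : ℤ
    L = + toℕ a ℤ.* + T ℤ.+ σ a b ℤ.* + x w
    Z = L ℤ.- + y w
    eq₁ : ∀ i → 1ℤ ℤ.* (i ℤ.+ i) ≡ i ℤ.+ i
    eq₁ = solve-∀
    eq₂ : ∀ i → (ℤ.- 1ℤ) ℤ.* (i ℤ.+ i) ≡ (ℤ.- i) ℤ.+ (ℤ.- i)
    eq₂ = solve-∀
    eq₃ : ∀ i j → ℤ.- (i ℤ.- j) ≡ j ℤ.- i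
    eq₃ = solve-∀
    0≤Z : 0ℤ ℤ.≤ Z
    0≤Z = 0≤i+i⇒0≤i Z (subst (0ℤ ℤ.≤_) (eq₁ Z) (deviation plus a b p q le))
    0≤-Z : 0ℤ ℤ.≤ ℤ.- Z
    0≤-Z = 0≤i+i⇒0≤i (ℤ.- Z) (subst (0ℤ ℤ.≤_) (eq₂ Z) (deviation minus a b p q le))

  -- The potential at the slope of the segment is tight on it: the tilt cancels along the line, and
  -- the rise from end to end equals the length.
  lineDist : ∀ a b → IsDist G (left a) (right b) (lineLength a b / 1)
  lineDist a b = subst₂ (λ u v → Walk G u v (lineLength a b / 1)) (point-0 a b) (point-T a b) (lineWalk a b T zero refl) , least
    where
    m = slope-σ a b
    eq : ∀ h m A T →
      let C = h ℤ.* h ℤ.+ h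
          ψ = λ X Y → (C ℤ.- m ℤ.* m ℤ.- 1ℤ ℤ.* m) ℤ.* X ℤ.+ (m ℤ.+ m ℤ.+ 1ℤ) ℤ.* Y
      in ψ 0ℤ A ℤ.+ (T ℤ.* (C ℤ.+ m ℤ.* m)) ≡ ψ T (A ℤ.+ m ℤ.* T)
    eq = solve-∀
    rise : potential 1ℤ (σ a b) (left a) ℤ.+ lineLength a b ≡ potential 1ℤ (σ a b) (right b)
    rise = trans (cong (ℤ._+ lineLength a b) (potential-left 1ℤ (σ a b) a))
      (trans (eq (+ H) (σ a b) (+ toℕ a ℤ.* + T) (+ T)) (sym (potential-right 1ℤ (σ a b) a b)))
    cancel : ∀ p {i j} → p ℤ.+ i ℤ.≤ p ℤ.+ j → i ℤ.≤ j
    cancel p {i} {j} le = subst₂ ℤ._≤_ (undo p i) (undo p j) (ℤ.+-monoʳ-≤ (ℤ.- p) le)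
      where
      undo : ∀ p i → (ℤ.- p) ℤ.+ (p ℤ.+ i) ≡ i
      undo = solve-∀
    least : ∀ d → Walk G (left a) (right b) d → lineLength a b / 1 ≤ d
    least d w with potential-walk w
    ... | z , refl , le = /1-mono-≤ (cancel (potential 1ℤ (σ a b) (left a))
      (subst (ℤ._≤ potential 1ℤ (σ a b) (left a) ℤ.+ z) (sym rise) (le plus m)))

  -- Subtract the equations of the two lines at `w`.
  onLines⇒column : ∀ a b a' b' {α β} → toℕ a' ≡ α ℕ.+ toℕ a → toℕ b ≡ β ℕ.+ toℕ b' → ∀ w →
    + y w ≡ + toℕ a ℤ.* + T ℤ.+ σ a b ℤ.* + x w →
    + y w ≡ + toℕ a' ℤ.* + T ℤ.+ σ a' b' ℤ.* + x w →
    α ℕ.* T ≡ (α ℕ.+ β) ℕ.* x w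
  onLines⇒column a b a' b' {α} {β} a'≡ b≡ w on on' = ℤ.+-injective (begin
    + (α ℕ.* T)                        ≡⟨ ℤ.pos-* α T ⟩
    + α ℤ.* + T                        ≡⟨ eq (+ toℕ a) (+ toℕ b') (+ α) (+ β) (+ T) (+ x w) ⟩
    lhs ℤ.- rhs ℤ.+ (+ α ℤ.+ + β) ℤ.* + x w
                                       ≡⟨ cong (ℤ._+ (+ α ℤ.+ + β) ℤ.* + x w) (trans (cong (λ s → lhs ℤ.- s) (sym lhs≡rhs)) (ℤ.+-inverseʳ lhs)) ⟩
    0ℤ ℤ.+ (+ α ℤ.+ + β) ℤ.* + x w     ≡⟨ ℤ.+-identityˡ _ ⟩
    (+ α ℤ.+ + β) ℤ.* + x w            ≡⟨ ℤ.pos-* (α ℕ.+ β) (x w) ⟨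
    + ((α ℕ.+ β) ℕ.* x w)              ∎)
    where
    open ≡-Reasoning
    lhs rhs : ℤ
    lhs = (+ α ℤ.+ + toℕ a) ℤ.* + T ℤ.+ (+ toℕ b' ℤ.- (+ α ℤ.+ + toℕ a)) ℤ.* + x w
    rhs = + toℕ a ℤ.* + T ℤ.+ ((+ β ℤ.+ + toℕ b') ℤ.- + toℕ a) ℤ.* + x w
    lhs≡rhs : lhs ≡ rhs
    lhs≡rhs = trans (cong (λ s → + s ℤ.* + T ℤ.+ (+ toℕ b' ℤ.- + s) ℤ.* + x w) (sym a'≡))
      (trans (sym on') (trans on (cong (λ s → + toℕ a ℤ.* + T ℤ.+ (+ s ℤ.- + toℕ a) ℤ.* + x w) b≡)))
    eq : ∀ a b' α β T X → α ℤ.* T ≡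
      ((α ℤ.+ a) ℤ.* T ℤ.+ (b' ℤ.- (α ℤ.+ a)) ℤ.* X) ℤ.- (a ℤ.* T ℤ.+ ((β ℤ.+ b') ℤ.- a) ℤ.* X)
        ℤ.+ (α ℤ.+ β) ℤ.* X
    eq = solve-∀

  -- Survival of crossings in minors

  module _ .{{_ : ℕ.NonZero T}} {G' : Graph} (M : MinorModel G G') {k : ℕ} (R : Fin k → V)
           (dpm : DistPreservingMinor G G' M R) (nc : NonContracting G G' M) where

    onShortest⇒onLine : ∀ a b {u v z} (w : Walk G' u v (lineLength a b / 1)) →
      ι M u ≡ left a → ι M v ≡ right b → IsDist G' u v (lineLength a b / 1) → On z w →
      + y (ι M z) ≡ + toℕ a ℤ.* + T ℤ.+ σ a b ℤ.* + x (ι M z)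
    onShortest⇒onLine a b {z = z} w ιu ιv dist on with noncontracting⇒through M nc w dist on
    ... | d₁ , d₂ , p , q , le = through⇒onLine a b
            (subst (λ s → Walk G s (ι M z) d₁) ιu p) (subst (λ s → Walk G (ι M z) s d₂) ιv q) le

    IsTerminal : V → Set
    IsTerminal v = ∃ λ i → R i ≡ v

    shortest : ∀ a b → IsTerminal (left a) → IsTerminal (right b) →
      ∃ λ u → ∃ λ v → ι M u ≡ left a × ι M v ≡ right b × IsDist G' u v (lineLength a b / 1)
    shortest a b (i , Ri) (j , Rj) =
      let _ , survive , dist = dpm
          u , ιu = survive i
          v , ιv = survive j
      in u , v , trans ιu Ri , trans ιv Rj ,
         proj₁ (dist i j u v ιu ιv _) (subst₂ (λ s t → IsDist G s t (lineLength a b / 1)) (sym Ri) (sym Rj) (lineDist a b))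

    -- A vertex shared by the two shortest walks of the minor is identified with a point of both
    -- lines. If none is shared, the lifted walks are disjoint although their ends are in opposite
    -- orders, against `disjoint-ordered`.
    crossing-survives : ∀ a b a' b' {α β} →
      toℕ a' ≡ suc α ℕ.+ toℕ a → toℕ b ≡ suc β ℕ.+ toℕ b' →
      IsTerminal (left a) → IsTerminal (right b) → IsTerminal (left a') → IsTerminal (right b') →
      ∃ λ z → suc α ℕ.* T ≡ (suc α ℕ.+ suc β) ℕ.* x (ι M z)
    crossing-survives a b a' b' {α} {β} a'≡ b≡ La Rb La' Rb' =
      cross (shortest a b La Rb) (shortest a' b' La' Rb')
      where
      branch-ι : ∀ {u c} → ι M u ≡ c → branch M c ≡ just u
      branch-ι {u} refl = ι-in M u
      below : y (left a) ℕ.< y (left a')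
      below = subst₂ ℕ._<_ (sym (y-left a)) (sym (y-left a'))
        (ℕ.*-monoˡ-< T (subst (toℕ a ℕ.<_) (sym a'≡) (ℕ.s≤s (ℕ.m≤n+m (toℕ a) α))))
      below' : y (right b') ℕ.< y (right b)
      below' = subst₂ ℕ._<_ (sym (y-right b')) (sym (y-right b))
        (ℕ.*-monoˡ-< T (subst (toℕ b' ℕ.<_) (sym b≡) (ℕ.s≤s (ℕ.m≤n+m (toℕ b') β))))
      cross : (∃ λ u → ∃ λ v → ι M u ≡ left a × ι M v ≡ right b × IsDist G' u v (lineLength a b / 1)) →
        (∃ λ u → ∃ λ v → ι M u ≡ left a' × ι M v ≡ right b' × IsDist G' u v (lineLength a' b' / 1)) →
        ∃ λ z → suc α ℕ.* T ≡ (suc α ℕ.+ suc β) ℕ.* x (ι M z)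
      cross (u , v , ιu , ιv , dist@(w , _)) (u' , v' , ιu' , ιv' , dist'@(w' , _)) =
        -- The minor is finite, so it is decidable whether the walks share a vertex.
        decide (Fin.any? (λ z → on? z w ×-dec on? z w'))
        where
        decide : Dec (∃ λ z → On z w × On z w') →
                 ∃ λ z → suc α ℕ.* T ≡ (suc α ℕ.+ suc β) ℕ.* x (ι M z)
        decide (yes (z , on , on')) = z , onLines⇒column a b a' b' a'≡ b≡ (ι M z)
          (onShortest⇒onLine a b w ιu ιv dist on) (onShortest⇒onLine a' b' w' ιu' ιv' dist' on')
        decide (no ¬shared) = contradiction below' (disjoint-ordered (BranchOn-disjoint M ¬shared)
          (u , on-start w , branch-ι ιu) (u' , on-start w' , branch-ι ιu')
          (liftWalk M w (branch-ι ιu) (branch-ι ιv))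
          (x-left a) (x-right b) (x-left a') (x-right b')
          (liftWalk M w' (branch-ι ιu') (branch-ι ιv')) below)

-- Terminals and counting

digits-injective : ∀ B {p p' r r'} → r ℕ.< B → r' ℕ.< B →
                   B ℕ.* p ℕ.+ r ≡ B ℕ.* p' ℕ.+ r' → p ≡ p' × r ≡ r'
digits-injective B {p} {p'} {r} {r'} r<B r'<B eq with p≡p'
  where
  large : ∀ {p p' r r'} → r ℕ.< B → B ℕ.* p ℕ.+ r ≡ B ℕ.* p' ℕ.+ r' → p' ℕ.≤ p
  large {p} {p'} {r} {r'} r<B eq = ℕ.≮⇒≥ λ p<p' → ℕ.<-irrefl eq (begin-strict
    B ℕ.* p ℕ.+ r   <⟨ ℕ.+-monoʳ-< (B ℕ.* p) r<B ⟩
    B ℕ.* p ℕ.+ B   ≡⟨ trans (ℕ.+-comm (B ℕ.* p) B) (sym (ℕ.*-suc B p)) ⟩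
    B ℕ.* suc p     ≤⟨ ℕ.*-monoʳ-≤ B p<p' ⟩
    B ℕ.* p'        ≤⟨ ℕ.m≤m+n (B ℕ.* p') r' ⟩
    B ℕ.* p' ℕ.+ r' ∎)
    where open ℕ.≤-Reasoning
  p≡p' : p ≡ p'
  p≡p' = ℕ.≤-antisym (large r'<B (sym eq)) (large r<B eq)
... | refl = refl , ℕ.+-cancelˡ-≡ (B ℕ.* p) r r' eq

-- Multiply the first equation by the reversed second one and cancel `T t`; here `t` is nonzero
-- because `α T` is.
column⇒ratio : ∀ α β α' β' T t .{{_ : ℕ.NonZero T}} .{{_ : ℕ.NonZero α}} →
  α ℕ.* T ≡ (α ℕ.+ β) ℕ.* t → α' ℕ.* T ≡ (α' ℕ.+ β') ℕ.* t → α ℕ.* β' ≡ α' ℕ.* β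
column⇒ratio α β α' β' T zero eq eq' =
  contradiction (trans eq (ℕ.*-zeroʳ (α ℕ.+ β))) (ℕ.≢-nonZero⁻¹ (α ℕ.* T) {{ℕ.m*n≢0 α T}})
column⇒ratio α β α' β' T t@(suc _) eq eq' =
  ℕ.+-cancelˡ-≡ (α ℕ.* α') _ _ (ℕ.*-cancelʳ-≡ _ _ (T ℕ.* t) {{ℕ.m*n≢0 T t}} (begin
    (α ℕ.* α' ℕ.+ α ℕ.* β') ℕ.* (T ℕ.* t)      ≡⟨ regroup α α' β' T t ⟩
    (α ℕ.* T) ℕ.* ((α' ℕ.+ β') ℕ.* t)          ≡⟨ cong₂ ℕ._*_ eq (sym eq') ⟩
    ((α ℕ.+ β) ℕ.* t) ℕ.* (α' ℕ.* T)           ≡⟨ regroup' α β α' T t ⟩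
    (α ℕ.* α' ℕ.+ α' ℕ.* β) ℕ.* (T ℕ.* t)      ∎))
  where
  open ≡-Reasoning
  regroup : ∀ α α' β' T t → (α ℕ.* α' ℕ.+ α ℕ.* β') ℕ.* (T ℕ.* t) ≡ (α ℕ.* T) ℕ.* ((α' ℕ.+ β') ℕ.* t)
  regroup = ℕ-Ring.solve-∀
  regroup' : ∀ α β α' T t → ((α ℕ.+ β) ℕ.* t) ℕ.* (α' ℕ.* T) ≡ (α ℕ.* α' ℕ.+ α' ℕ.* β) ℕ.* (T ℕ.* t)
  regroup' = ℕ-Ring.solve-∀

fourth-* : ∀ m n → (m ℕ.* n) ^ 4 ≡ n ^ 4 ℕ.* m ^ 4
fourth-* m n = begin
  (m ℕ.* n) ^ 4                                ≡⟨ unfold m n ⟩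
  (n ℕ.* (n ℕ.* (n ℕ.* n))) ℕ.* (m ℕ.* (m ℕ.* (m ℕ.* m)))
    ≡⟨ cong₂ (λ a b → (n ℕ.* (n ℕ.* (n ℕ.* a))) ℕ.* (m ℕ.* (m ℕ.* (m ℕ.* b)))) (ℕ.*-identityʳ n) (ℕ.*-identityʳ m) ⟨
  n ^ 4 ℕ.* m ^ 4                              ∎
  where
  open ≡-Reasoning
  unfold : ∀ m n → (m ℕ.* n) ℕ.* ((m ℕ.* n) ℕ.* ((m ℕ.* n) ℕ.* ((m ℕ.* n) ℕ.* 1)))
           ≡ (n ℕ.* (n ℕ.* (n ℕ.* n))) ℕ.* (m ℕ.* (m ℕ.* (m ℕ.* m)))
  unfold = ℕ-Ring.solve-∀

-- For positive `n`, `k` is at most `4 (n + 1)`, hence at most `8 n`, and 4096 is the fourth power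
-- of 8. For `n = 0`, 1 takes the place of `n`, which is where `1 ≤ s` enters.
quarter-power : ∀ {k s} n → k ℕ.≤ suc n ℕ.* 4 → n ^ 4 ℕ.≤ s → 1 ℕ.≤ s → k ^ 4 ℕ.≤ s ℕ.* 4096
quarter-power {k} {s} n k≤ n⁴≤s 1≤s = eightfold n k≤ n⁴≤s
  where
  open ℕ.≤-Reasoning
  power : ∀ N → k ℕ.≤ 8 ℕ.* N → N ^ 4 ℕ.≤ s → k ^ 4 ℕ.≤ s ℕ.* 4096
  power N k≤8N N⁴≤s = begin
    k ^ 4              ≤⟨ ℕ.^-monoˡ-≤ 4 k≤8N ⟩
    (8 ℕ.* N) ^ 4      ≡⟨ fourth-* 8 N ⟩
    N ^ 4 ℕ.* 4096     ≤⟨ ℕ.*-monoˡ-≤ 4096 N⁴≤s ⟩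
    s ℕ.* 4096         ∎
  eightfold : ∀ n → k ℕ.≤ suc n ℕ.* 4 → n ^ 4 ℕ.≤ s → k ^ 4 ℕ.≤ s ℕ.* 4096
  eightfold zero k≤4 _ = power 1 (ℕ.≤-trans k≤4 (ℕ.m≤n+m 4 4)) 1≤s
  eightfold N@(suc _) k≤4+4N N⁴≤s = power N (begin
    k                   ≤⟨ k≤4+4N ⟩
    4 ℕ.+ N ℕ.* 4       ≤⟨ ℕ.+-monoˡ-≤ (N ℕ.* 4) (ℕ.m≤n*m 4 N) ⟩
    N ℕ.* 4 ℕ.+ N ℕ.* 4 ≡⟨ trans (sym (ℕ.*-distribˡ-+ N 4 4)) (ℕ.*-comm N 8) ⟩
    8 ℕ.* N             ∎) N⁴≤s

remQuot-injective : ∀ m n → Injective _≡_ _≡_ (remQuot {m} n)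
remQuot-injective m n {i} {j} eq =
  trans (sym (Fin.combine-remQuot {m} n i)) (trans (cong (uncurry combine) eq) (Fin.combine-remQuot {m} n j))

suc∣! : ∀ N m → suc m ℕ.≤ N → suc m ℕ.∣ N !
suc∣! N m m<N = ℕ.∣-trans (ℕ.m∣m*n (m !)) (ℕ.m≤n⇒m!∣n! m<N)

module Terminals (k : ℕ) where

  -- `n` is the number of complete groups of four terminals and `B` the base in which pairs of
  -- indices are encoded; `K` bounds the gaps, `L` their products, and `H` is the largest height.
  n B K L H : ℕ
  n = k ℕ./ 4
  B = suc n
  K = B ℕ.* B
  L = K ℕ.* K
  H = L ℕ.+ K

  -- Differences of slopes are at most `2 H` in absolute value, so this factorial is divisible by
  -- all nonzero ones. Opacity keeps it from being unfolded.
  opaque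
    T : ℕ
    T = (H ℕ.+ H) !

    T≢0 : ℕ.NonZero T
    T≢0 = (H ℕ.+ H) ℕ.!≢0

    T-divisible : ∀ m → suc m ℕ.≤ H ℕ.+ H → suc m ℕ.∣ T
    T-divisible = suc∣! (H ℕ.+ H)

  instance
    T-nonZero : ℕ.NonZero T
    T-nonZero = T≢0

  open Grid H T T-divisible public

  B*suc≤K : ∀ (q : Fin B) → B ℕ.* suc (toℕ q) ℕ.≤ K
  B*suc≤K q = ℕ.*-monoʳ-≤ B (Fin.toℕ<n q)

  B≤B*suc : ∀ q → B ℕ.≤ B ℕ.* suc q
  B≤B*suc q = ℕ.m≤m*n B (suc q)

  low<H : ∀ (q : Fin B) → toℕ q ℕ.< suc H
  low<H q = ℕ.m≤n⇒m≤1+n (ℕ.≤-trans (Fin.toℕ<n q)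
    (ℕ.≤-trans (ℕ.m≤m*n B B) (ℕ.m≤n+m K L)))

  mid<H : ∀ (q : Fin B) → B ℕ.* suc (toℕ q) ℕ.< suc H
  mid<H q = ℕ.s≤s (ℕ.≤-trans (B*suc≤K q) (ℕ.m≤n+m K L))

  top<H : ∀ (q : Fin B) → L ℕ.+ B ℕ.* suc (toℕ q) ℕ.< suc H
  top<H q = ℕ.s≤s (ℕ.+-monoʳ-≤ L (B*suc≤K q))

  -- The heights `low` act as units digits and `mid` as multiples of the base `B`, so that a
  -- difference of a `mid` and a `low` determines both indices. The heights `top` are the `mid` ones
  -- raised by `L`.
  low mid top : Fin B → Height
  low q = fromℕ< (low<H q)
  mid q = fromℕ< (mid<H q)
  top q = fromℕ< (top<H q)

  terminal : Fin B × Fin 4 → V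
  terminal (q , 0F) = left (low q)
  terminal (q , 1F) = left (mid q)
  terminal (q , 2F) = right (low q)
  terminal (q , 3F) = right (top q)

  left-injective : ∀ {a b} → left a ≡ left b → toℕ a ≡ toℕ b
  left-injective {a} {b} eq = ℕ.*-cancelʳ-≡ (toℕ a) (toℕ b) T
    (trans (sym (y-left a)) (trans (cong y eq) (y-left b)))

  right-injective : ∀ {a b} → right a ≡ right b → toℕ a ≡ toℕ b
  right-injective {a} {b} eq = ℕ.*-cancelʳ-≡ (toℕ a) (toℕ b) T
    (trans (sym (y-right a)) (trans (cong y eq) (y-right b)))

  left≢right : ∀ a b → left a ≢ right b
  left≢right a b eq = ℕ.≢-nonZero⁻¹ T (trans (sym (x-right b)) (trans (cong x (sym eq)) (x-left a)))

  low-injective : ∀ q r → toℕ (low q) ≡ toℕ (low r) → q ≡ r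
  low-injective q r eq = Fin.toℕ-injective
    (trans (sym (Fin.toℕ-fromℕ< (low<H q))) (trans eq (Fin.toℕ-fromℕ< (low<H r))))

  mid-injective : ∀ q r → toℕ (mid q) ≡ toℕ (mid r) → q ≡ r
  mid-injective q r eq = Fin.toℕ-injective (ℕ.suc-injective (ℕ.*-cancelˡ-≡ _ _ B
    (trans (sym (Fin.toℕ-fromℕ< (mid<H q))) (trans eq (Fin.toℕ-fromℕ< (mid<H r))))))

  top-injective : ∀ q r → toℕ (top q) ≡ toℕ (top r) → q ≡ r
  top-injective q r eq = Fin.toℕ-injective (ℕ.suc-injective (ℕ.*-cancelˡ-≡ _ _ B (ℕ.+-cancelˡ-≡ L _ _
    (trans (sym (Fin.toℕ-fromℕ< (top<H q))) (trans eq (Fin.toℕ-fromℕ< (top<H r)))))))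

  low≢mid : ∀ q r → toℕ (low q) ≢ toℕ (mid r)
  low≢mid q r eq = ℕ.<-irrefl
    (trans (sym (Fin.toℕ-fromℕ< (low<H q))) (trans eq (Fin.toℕ-fromℕ< (mid<H r))))
    (ℕ.<-≤-trans (Fin.toℕ<n q) (B≤B*suc (toℕ r)))

  low≢top : ∀ q r → toℕ (low q) ≢ toℕ (top r)
  low≢top q r eq = ℕ.<-irrefl
    (trans (sym (Fin.toℕ-fromℕ< (low<H q))) (trans eq (Fin.toℕ-fromℕ< (top<H r))))
    (ℕ.<-≤-trans (Fin.toℕ<n q) (ℕ.≤-trans (B≤B*suc (toℕ r)) (ℕ.m≤n+m _ L)))

  terminal-injective : ∀ s t → terminal s ≡ terminal t → s ≡ t
  terminal-injective (q , 0F) (r , 0F) eq = cong (_, 0F) (low-injective q r (left-injective eq))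
  terminal-injective (q , 1F) (r , 1F) eq = cong (_, 1F) (mid-injective q r (left-injective eq))
  terminal-injective (q , 2F) (r , 2F) eq = cong (_, 2F) (low-injective q r (right-injective eq))
  terminal-injective (q , 3F) (r , 3F) eq = cong (_, 3F) (top-injective q r (right-injective eq))
  terminal-injective (q , 0F) (r , 1F) eq = contradiction (left-injective eq) (low≢mid q r)
  terminal-injective (q , 1F) (r , 0F) eq = contradiction (left-injective (sym eq)) (low≢mid r q)
  terminal-injective (q , 2F) (r , 3F) eq = contradiction (right-injective eq) (low≢top q r)
  terminal-injective (q , 3F) (r , 2F) eq = contradiction (right-injective (sym eq)) (low≢top r q)
  terminal-injective (q , 0F) (r , 2F) eq = contradiction eq (left≢right (low q) (low r))
  terminal-injective (q , 0F) (r , 3F) eq = contradiction eq (left≢right (low q) (top r))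
  terminal-injective (q , 1F) (r , 2F) eq = contradiction eq (left≢right (mid q) (low r))
  terminal-injective (q , 1F) (r , 3F) eq = contradiction eq (left≢right (mid q) (top r))
  terminal-injective (q , 2F) (r , 0F) eq = contradiction (sym eq) (left≢right (low r) (low q))
  terminal-injective (q , 2F) (r , 1F) eq = contradiction (sym eq) (left≢right (mid r) (low q))
  terminal-injective (q , 3F) (r , 0F) eq = contradiction (sym eq) (left≢right (low r) (top q))
  terminal-injective (q , 3F) (r , 1F) eq = contradiction (sym eq) (left≢right (mid r) (top q))

  k≤B*4 : k ℕ.≤ B ℕ.* 4
  k≤B*4 = ℕ.≤-trans (ℕ.≤-reflexive (ℕ.m≡m%n+[m/n]*n k 4)) (ℕ.+-monoˡ-≤ (n ℕ.* 4) (ℕ.<⇒≤ (ℕ.m%n<n k 4)))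

  n*4≤k : n ℕ.* 4 ℕ.≤ k
  n*4≤k = ℕ.m/n*n≤m k 4

  -- As `k` lies between `4 n` and `4 B`, the first `k` of the `4 B` candidates include the first
  -- `n` groups of four.
  R : Fin k → V
  R i = terminal (remQuot {B} 4 (inject≤ i k≤B*4))

  R-injective : Injective _≡_ _≡_ R
  R-injective eq = Fin.inject≤-injective k≤B*4 k≤B*4 _ _ (remQuot-injective B 4 (terminal-injective _ _ eq))

  index : Fin n → Fin 4 → Fin k
  index q g = inject≤ (combine q g) n*4≤k

  R-index : ∀ q g → R (index q g) ≡ terminal (inject₁ q , g)
  R-index q g = cong terminal (trans (cong (remQuot {B} 4) (Fin.toℕ-injective (begin
    toℕ (inject≤ (inject≤ (combine q g) n*4≤k) k≤B*4) ≡⟨ Fin.toℕ-inject≤ (inject≤ (combine q g) n*4≤k) k≤B*4 ⟩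
    toℕ (inject≤ (combine q g) n*4≤k)                 ≡⟨ Fin.toℕ-inject≤ (combine q g) n*4≤k ⟩
    toℕ (combine q g)                                 ≡⟨ Fin.toℕ-combine q g ⟩
    4 ℕ.* toℕ q ℕ.+ toℕ g                             ≡⟨ cong (λ s → 4 ℕ.* s ℕ.+ toℕ g) (Fin.toℕ-inject₁ q) ⟨
    4 ℕ.* toℕ (inject₁ q) ℕ.+ toℕ g                   ≡⟨ Fin.toℕ-combine (inject₁ q) g ⟨
    toℕ (combine (inject₁ q) g)                       ∎)))
    (Fin.remQuot-combine {B} (inject₁ q) g))
    where open ≡-Reasoning

  -- One less than the difference of the heights of mid p and low q, for each pair (p , q).
  gap : Fin n × Fin n → ℕ
  gap (p , q) = B ℕ.* suc (toℕ p) ℕ.∸ suc (toℕ q)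

  gap-spec : ∀ p q → suc (gap (p , q)) ℕ.+ toℕ q ≡ B ℕ.* suc (toℕ p)
  gap-spec p q = trans (sym (ℕ.+-suc (gap (p , q)) (toℕ q)))
    (ℕ.m∸n+n≡m (ℕ.≤-trans (ℕ.m≤n⇒m≤1+n (Fin.toℕ<n q)) (B≤B*suc (toℕ p))))

  gap<K : ∀ s → gap s ℕ.< K
  gap<K (p , q) = ℕ.≤-trans (ℕ.m≤m+n (suc (gap (p , q))) (toℕ q))
    (ℕ.≤-trans (ℕ.≤-reflexive (gap-spec p q)) (ℕ.*-monoʳ-≤ B (ℕ.m≤n⇒m≤1+n (Fin.toℕ<n p))))

  -- Adding both `q` and `q'` to equal gaps removes the subtraction and leaves two expansions in
  -- base `B`.
  gap-injective : ∀ s t → gap s ≡ gap t → s ≡ t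
  gap-injective s@(p , q) t@(p' , q') eq =
    let sp≡sp' , q'≡q = digits-injective B (ℕ.m≤n⇒m≤1+n (Fin.toℕ<n q')) (ℕ.m≤n⇒m≤1+n (Fin.toℕ<n q)) (begin
          B ℕ.* suc (toℕ p) ℕ.+ toℕ q'            ≡⟨ cong (ℕ._+ toℕ q') (gap-spec p q) ⟨
          suc (gap s) ℕ.+ toℕ q ℕ.+ toℕ q'        ≡⟨ swap (suc (gap s)) (toℕ q) (toℕ q') ⟩
          suc (gap s) ℕ.+ toℕ q' ℕ.+ toℕ q        ≡⟨ cong (λ g → suc g ℕ.+ toℕ q' ℕ.+ toℕ q) eq ⟩
          suc (gap t) ℕ.+ toℕ q' ℕ.+ toℕ q        ≡⟨ cong (ℕ._+ toℕ q) (gap-spec p' q') ⟩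
          B ℕ.* suc (toℕ p') ℕ.+ toℕ q            ∎)
    in cong₂ _,_ (Fin.toℕ-injective (ℕ.suc-injective sp≡sp')) (Fin.toℕ-injective (sym q'≡q))
    where
    open ≡-Reasoning
    swap : ∀ a b c → a ℕ.+ b ℕ.+ c ≡ a ℕ.+ c ℕ.+ b
    swap = ℕ-Ring.solve-∀

  -- The offset L makes α / β determine α and β: all products of gaps are below suc L.
  ratio-injective : ∀ s t s' t' →
    suc (gap s) ℕ.* suc (L ℕ.+ gap t') ≡ suc (gap s') ℕ.* suc (L ℕ.+ gap t) → (s , t) ≡ (s' , t')
  ratio-injective s t s' t' eq =
    let α≡α' , αv'≡α'v = digits-injective (suc L) (small s t') (small s' t)
                           (trans (sym (expand (gap s) L (gap t'))) (trans eq (expand (gap s') L (gap t))))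
        v'≡v = ℕ.*-cancelˡ-≡ _ _ (suc (gap s')) (trans (cong (ℕ._* gap t') (sym α≡α')) αv'≡α'v)
    in cong₂ _,_ (gap-injective s s' (ℕ.suc-injective α≡α')) (gap-injective t t' (sym v'≡v))
    where
    small : ∀ s t → suc (gap s) ℕ.* gap t ℕ.< suc L
    small s t = ℕ.s≤s (ℕ.*-mono-≤ (gap<K s) (ℕ.<⇒≤ (gap<K t)))
    expand : ∀ g L v → suc g ℕ.* suc (L ℕ.+ v) ≡ suc L ℕ.* suc g ℕ.+ suc g ℕ.* v
    expand = ℕ-Ring.solve-∀

  -- Counting the surviving crossings

  module _ {G' : Graph} (M : MinorModel G G') (dpm : DistPreservingMinor G G' M R) (nc : NonContracting G G' M) where

    -- The segment from `low q` to `top p'` crosses the one from `mid p` to `low q'`: the pair `s`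
    -- fixes the difference on the left, `t` the one on the right.
    survivor : ∀ s t → ∃ λ z → suc (gap s) ℕ.* T ≡ (suc (gap s) ℕ.+ suc (L ℕ.+ gap t)) ℕ.* x (ι M z)
    survivor s@(p , q) t@(p' , q') =
      crossing-survives M R dpm nc (low (inject₁ q)) (top (inject₁ p')) (mid (inject₁ p)) (low (inject₁ q'))
        {gap s} {L ℕ.+ gap t} α-spec β-spec (index q 0F , R-index q 0F) (index p' 3F , R-index p' 3F)
        (index p 1F , R-index p 1F) (index q' 2F , R-index q' 2F)
      where
      open ≡-Reasoning
      toℕ-low : ∀ (q : Fin n) → toℕ (low (inject₁ q)) ≡ toℕ q
      toℕ-low q = trans (Fin.toℕ-fromℕ< (low<H (inject₁ q))) (Fin.toℕ-inject₁ q)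
      α-spec : toℕ (mid (inject₁ p)) ≡ suc (gap s) ℕ.+ toℕ (low (inject₁ q))
      α-spec = begin
        toℕ (mid (inject₁ p))                     ≡⟨ Fin.toℕ-fromℕ< (mid<H (inject₁ p)) ⟩
        B ℕ.* suc (toℕ (inject₁ p))               ≡⟨ cong (λ r → B ℕ.* suc r) (Fin.toℕ-inject₁ p) ⟩
        B ℕ.* suc (toℕ p)                         ≡⟨ gap-spec p q ⟨
        suc (gap s) ℕ.+ toℕ q                     ≡⟨ cong (suc (gap s) ℕ.+_) (toℕ-low q) ⟨
        suc (gap s) ℕ.+ toℕ (low (inject₁ q))     ∎
      β-spec : toℕ (top (inject₁ p')) ≡ suc (L ℕ.+ gap t) ℕ.+ toℕ (low (inject₁ q'))
      β-spec = begin
        toℕ (top (inject₁ p'))                    ≡⟨ Fin.toℕ-fromℕ< (top<H (inject₁ p')) ⟩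
        L ℕ.+ B ℕ.* suc (toℕ (inject₁ p'))        ≡⟨ cong (λ r → L ℕ.+ B ℕ.* suc r) (Fin.toℕ-inject₁ p') ⟩
        L ℕ.+ B ℕ.* suc (toℕ p')                  ≡⟨ cong (L ℕ.+_) (gap-spec p' q') ⟨
        L ℕ.+ (suc (gap t) ℕ.+ toℕ q')            ≡⟨ shift L (gap t) (toℕ q') ⟩
        suc (L ℕ.+ gap t) ℕ.+ toℕ q'              ≡⟨ cong (suc (L ℕ.+ gap t) ℕ.+_) (toℕ-low q') ⟨
        suc (L ℕ.+ gap t) ℕ.+ toℕ (low (inject₁ q')) ∎
        where
        shift : ∀ L g q → L ℕ.+ (suc g ℕ.+ q) ≡ suc (L ℕ.+ g) ℕ.+ q
        shift = ℕ-Ring.solve-∀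

    -- Equal survivors lie in the same column, so the two crossings have the same ratio `α / β`.
    survivor-injective : ∀ s t s' t' → proj₁ (survivor s t) ≡ proj₁ (survivor s' t') → (s , t) ≡ (s' , t')
    survivor-injective s t s' t' eq = ratio-injective s t s' t'
      (column⇒ratio (suc (gap s)) (suc (L ℕ.+ gap t)) (suc (gap s')) (suc (L ℕ.+ gap t')) T
        (x (ι M (proj₁ (survivor s t)))) (proj₂ (survivor s t))
        (subst (λ z → suc (gap s') ℕ.* T ≡ (suc (gap s') ℕ.+ suc (L ℕ.+ gap t')) ℕ.* x (ι M z))
               (sym eq) (proj₂ (survivor s' t'))))

    decode : Fin ((n ℕ.* n) ℕ.* (n ℕ.* n)) → (Fin n × Fin n) × (Fin n × Fin n)
    decode c = let a , b = remQuot {n ℕ.* n} (n ℕ.* n) c in remQuot {n} n a , remQuot {n} n b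

    decode-injective : Injective _≡_ _≡_ decode
    decode-injective eq =
      let a≡ , b≡ = ,-injective eq
      in remQuot-injective (n ℕ.* n) (n ℕ.* n) (cong₂ _,_ (remQuot-injective n n a≡) (remQuot-injective n n b≡))

    n⁴≤size : n ^ 4 ℕ.≤ size G'
    n⁴≤size = subst (ℕ._≤ size G') (fourth n)
      (Fin.injective⇒≤ {f = survive} λ {c} {d} eq → decode-injective
        (survivor-injective (proj₁ (decode c)) (proj₂ (decode c)) (proj₁ (decode d)) (proj₂ (decode d)) eq))
      where
      survive : Fin ((n ℕ.* n) ℕ.* (n ℕ.* n)) → Fin (size G')
      survive c = proj₁ (survivor (proj₁ (decode c)) (proj₂ (decode c)))
      fourth : ∀ n → (n ℕ.* n) ℕ.* (n ℕ.* n) ≡ n ℕ.* (n ℕ.* (n ℕ.* (n ℕ.* 1)))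
      fourth = ℕ-Ring.solve-∀

    k⁴≤size : 1 ℕ.≤ k → k ^ 4 ℕ.≤ size G' ℕ.* 4096
    k⁴≤size 1≤k = quarter-power n k≤B*4 n⁴≤size
      -- The minor has a vertex, since the first terminal survives.
      (ℕ.<-≤-trans (ℕ.s≤s ℕ.z≤n) (Fin.toℕ<n (proj₁ (proj₁ (proj₂ dpm) (fromℕ< 1≤k)))))

1/4096-*-≤ : ∀ m s → m ℕ.≤ s ℕ.* 4096 → + 1 / 4096 * ℕ→ℚ m ≤ ℕ→ℚ s
1/4096-*-≤ m s m≤ = ℚ.toℚᵘ-cancel-≤ (ℚᵘ.≤-respˡ-≃ (ℚᵘ.≃-sym (ℚᵘ.≃-trans
    (ℚ.toℚᵘ-homo-* (+ 1 / 4096) (ℕ→ℚ m)) (ℚᵘ.*-congˡ {toℚᵘ (+ 1 / 4096)} (toℚᵘ-/1 (+ m)))))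
  (ℚᵘ.≤-respʳ-≃ (ℚᵘ.≃-sym (toℚᵘ-/1 (+ s))) (ℚᵘ.*≤* (subst₂ ℤ._≤_
    (sym (trans (ℤ.*-identityʳ (+ 1 ℤ.* + m)) (ℤ.*-identityˡ (+ m)))) (ℤ.pos-* s 4096) (ℤ.+≤+ m≤)))))

theorem9 : Σ ℚ λ c → 0ℚ < c ×
    ((k : ℕ) → 1 Data.Nat.≤ k →
    Σ Graph λ G → NonnegLengths G ×
    Σ (Fin k → Fin (size G)) λ R → Injective _≡_ _≡_ R ×
    ((G' : Graph) (M : MinorModel G G') →
    DistPreservingMinor G G' M R → NonContracting G G' M →
    c * ℕ→ℚ (k ^ 4) ≤ ℕ→ℚ (size G')))
theorem9 = + 1 / 4096 , ℚ.*<* (ℤ.+<+ (ℕ.s≤s ℕ.z≤n)) , λ k 1≤k →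
  let open Terminals k in
  G , nonneg , R , R-injective , λ G' M dpm nc → 1/4096-*-≤ (k ^ 4) (size G') (k⁴≤size M dpm nc 1≤k)
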